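{- Let $n$ and $\Delta$ be positive integers such that $\Delta \ge \frac{2n-4}{3}$. Let $R$ be an $(n-1)$-vertex connected $\Delta$-regular simple graph of Class $1$, and let $G$ be an $n$-vertex graph obtained from $R$ by a vertex-splitting. Then $G$ is $\Delta$-critical.
   Context: All graphs are finite and simple. For a graph $G$, $\Delta(G)$ denotes its maximum degree. A $k$-edge-coloring of $G$ is a map $\varphi: E(G)\to\{1,\dots,k\}$ such that adjacent edges receive distinct colors; the chromatic index $\chi'(G)$ is the least $k$ for which a $k$-edge-coloring exists. By Vizing's theorem $\Delta(G)\le\chi'(G)\le\Delta(G)+1$; $G$ is of Class $1$ if $\chi'(G)=\Delta(G)$ and of Class $2$ otherwise. A graph $G$ is edge-chromatic critical if $\chi'(H)<\chi'(G)$ for every proper subgraph $H$ of $G$; $G$ is $\Delta$-critical if it is edge-chromatic critical and $\chi'(G)=\Delta+1$ where $\Delta=\Delta(G)$. A vertex-splitting of a graph $R$ at a vertex $v$ produces a new graph by replacing $v$ with two new adjacent vertices $v_1,v_2$ and partitioning $N_R(v)$ into two nonempty subsets which serve as the sets of neighbors of $v_1$ and of $v_2$, respectively, among the vertices of $R$ other than $v$. -}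

module Defs where

open import Data.Nat using (ℕ; zero; suc; _+_; _≤_; _<_)
open import Data.Fin using (Fin; zero; suc)
open import Data.Fin.Properties using (_≟_)
open import Data.Bool using (Bool; true; false; if_then_else_; _∧_; not)
open import Data.Product using (Σ; ∃; _×_; _,_)
open import Data.Sum using (_⊎_)
open import Relation.Nullary using (¬_; yes; no)
open import Relation.Binary.PropositionalEquality using (_≡_; _≢_; refl)

record Graph (n : ℕ) : Set where
  field
    Adj   : Fin n → Fin n → Bool
    sym   : ∀ x y → Adj x y ≡ Adj y x
    irref : ∀ x → Adj x x ≡ false
open Graph public

count : ∀ {n} → (Fin n → Bool) → ℕ
count {zero}  f = 0
count {suc n} f = (if f zero then 1 else 0) + count (λ i → f (suc i))

degree : ∀ {n} → Graph n → Fin n → ℕ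
degree G v = count (Adj G v)

IsMaxDegree : ∀ {n} → Graph n → ℕ → Set
IsMaxDegree {n} G d = (∀ v → degree G v ≤ d) × ((n ≡ 0 × d ≡ 0) ⊎ ∃ λ v → degree G v ≡ d)

Regular : ∀ {n} → Graph n → ℕ → Set
Regular G d = ∀ v → degree G v ≡ d

record EdgeColoring {n} (G : Graph n) (k : ℕ) : Set where
  field
    col    : Fin n → Fin n → Fin k
    colSym : ∀ x y → Adj G x y ≡ true → col x y ≡ col y x
    proper : ∀ x y z → Adj G x y ≡ true → Adj G x z ≡ true → y ≢ z → col x y ≢ col x z

HasEdgeColoring : ∀ {n} → Graph n → ℕ → Set
HasEdgeColoring G k = EdgeColoring G k

IsChromaticIndex : ∀ {n} → Graph n → ℕ → Set
IsChromaticIndex G k = HasEdgeColoring G k × (∀ j → HasEdgeColoring G j → k ≤ j)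

Class1 : ∀ {n} → Graph n → Set
Class1 G = ∀ d → IsMaxDegree G d → IsChromaticIndex G d

IsSubgraphVia : ∀ {m n} → Graph m → Graph n → (Fin m → Fin n) → Set
IsSubgraphVia H G f =
  (∀ a b → f a ≡ f b → a ≡ b) × (∀ a b → Adj H a b ≡ true → Adj G (f a) (f b) ≡ true)

IsProperVia : ∀ {m n} → Graph m → Graph n → (Fin m → Fin n) → Set
IsProperVia H G f =
  (∃ λ v → ∀ a → f a ≢ v) ⊎
  (∃ λ a → ∃ λ b → Adj G (f a) (f b) ≡ true × Adj H a b ≡ false)

EdgeChromaticCritical : ∀ {n} → Graph n → Set
EdgeChromaticCritical {n} G =
  ∀ (m : ℕ) (H : Graph m) (f : Fin m → Fin n) →
  IsSubgraphVia H G f → IsProperVia H G f →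
  ∀ k k' → IsChromaticIndex G k → IsChromaticIndex H k' → k' < k

ΔCritical : ∀ {n} → Graph n → Set
ΔCritical G = EdgeChromaticCritical G × (∀ d → IsMaxDegree G d → IsChromaticIndex G (suc d))

data Reach {n} (G : Graph n) : Fin n → Fin n → Set where
  here : ∀ {x} → Reach G x x
  step : ∀ {x y z} → Adj G x y ≡ true → Reach G y z → Reach G x z

Connected : ∀ {n} → Graph n → Set
Connected G = ∀ x y → Reach G x y

-- Vertex splitting of R (on Fin m) at v.  A : Fin m → Bool partitions
-- N_R(v): neighbours u with A u = true go to v₁, those with A u = false
-- to v₂.  In the split graph (on Fin (suc m)), v₁ = suc v, v₂ = zero,
-- and every other vertex u of R is suc u.

module Split {m : ℕ} (R : Graph m) (v : Fin m) (A : Fin m → Bool) where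

  toV2 : Fin m → Bool
  toV2 y with y ≟ v
  ... | yes _ = true
  ... | no  _ = Adj R y v ∧ not (A y)

  old : Fin m → Fin m → Bool
  old x y with x ≟ v | y ≟ v
  ... | yes _ | yes _ = false
  ... | yes _ | no _  = Adj R y v ∧ A y
  ... | no _  | yes _ = Adj R x v ∧ A x
  ... | no _  | no _  = Adj R x y

  adj : Fin (suc m) → Fin (suc m) → Bool
  adj zero    zero    = false
  adj zero    (suc y) = toV2 y
  adj (suc x) zero    = toV2 x
  adj (suc x) (suc y) = old x y

  oldSym : ∀ x y → old x y ≡ old y x
  oldSym x y with x ≟ v | y ≟ v
  ... | yes _ | yes _ = refl
  ... | yes _ | no _  = refl
  ... | no _  | yes _ = refl
  ... | no _  | no _  = sym R x y

  oldIrr : ∀ x → old x x ≡ false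
  oldIrr x with x ≟ v
  ... | yes _ = refl
  ... | no _  = irref R x

  adjSym : ∀ x y → adj x y ≡ adj y x
  adjSym zero zero = refl
  adjSym zero (suc y) = refl
  adjSym (suc x) zero = refl
  adjSym (suc x) (suc y) = oldSym x y

  adjIrr : ∀ x → adj x x ≡ false
  adjIrr zero = refl
  adjIrr (suc x) = oldIrr x

  graph : Graph (suc m)
  graph = record { Adj = adj ; sym = adjSym ; irref = adjIrr }

splitGraph : ∀ {m} → Graph m → Fin m → (Fin m → Bool) → Graph (suc m)
splitGraph R v A = Split.graph R v A

ValidSplit : ∀ {m} → Graph m → Fin m → (Fin m → Bool) → Set
ValidSplit R v A =
  (∃ λ u → Adj R u v ≡ true × A u ≡ true) × (∃ λ u → Adj R u v ≡ true × A u ≡ false)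

{-# OPTIONS --safe #-}
module Submission where

-- G is overfull: it has an odd number of vertices, while every colour class of a Δ-colouring of R
-- is a perfect matching, so G needs Δ + 1 colours.  For criticality it suffices to Δ-colour G − f
-- for every edge f.  A Δ-colouring of R is a Δ-colouring of G − v₁v₂ in which each colour is
-- missing at exactly one of v₁, v₂.  Starting from it, Kempe changes and recolourings near v move
-- the uncoloured edge to f = zw.  If f is not close to v, the degree condition yields a common
-- neighbour u of z and v, and the path v₂ v₁ u z w is handled as in the Kierstead path lemma when
-- v₁ misses two colours.  Otherwise v₂ has a single neighbour u₀ besides v₁; then either u₀ is
-- adjacent to z, and v₁ v₂ u₀ z w is such a path, or the degree condition gives a common neighbour
-- x of v, u₀ and z, and the kite v₁ v₂ u₀ x with tail x z w is used instead.
--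
-- Each local argument is a game: the state records which colours are missing at finitely many
-- terminals, a move asks where the Kempe chain starting at a terminal ends or exchanges the colours
-- along a chain, and the goal is a state in which the local edges can be coloured greedily.
-- Winning strategies are explicit finite trees, checked by evaluation.

open import Defs
open import Data.Bool using (Bool; true; false; _∧_; _∨_; not; if_then_else_; _xor_)
open import Data.Bool.Properties using (∨-zeroʳ; not-involutive) renaming (_≟_ to _≟ᵇ_)
open import Data.Fin using (Fin; zero; suc; punchIn; punchOut; inject≤)
open import Data.Fin.Patterns using (0F; 1F; 2F; 3F; 4F; 5F)
open import Data.Fin.Properties using (_≟_; any?; all?; suc-injective; 0≢1+n; injective⇒≤; punchOut-injective; punchInᵢ≢i; punchIn-injective; inject≤-injective)
open import Data.List using (List; []; _∷_; [_]; _++_; map; filterᵇ)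
import Data.List.Membership.DecPropositional as Membership
open import Data.List.Membership.Propositional using (_∈_; lose)
open import Data.List.Relation.Unary.All using (All; []; _∷_) renaming (lookup to lookupAll)
open import Data.List.Relation.Unary.Any using (Any; here; there)
open import Data.Nat using (ℕ; zero; suc; _+_; _*_; _≤_; _<_; z≤n; s≤s; _≤?_)
open import Data.Nat.ListAction using (sum)
open import Data.Nat.Properties using (≤-refl; ≤-trans; ≤-reflexive; ≤-antisym; ≤-pred; ≰⇒>; 1+n≰n; m≤n+m; +-mono-≤; +-cancelˡ-≤; *-monoʳ-≤; *-identityʳ; module ≤-Reasoning)
open import Data.Nat.Tactic.RingSolver using (solve-∀)
open import Data.Product using (∃; ∃₂; _×_; _,_; proj₁; proj₂)
open import Data.Product.Properties using (≡-dec)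
open import Data.Sum using (_⊎_; inj₁; inj₂; [_,_]′)
open import Data.Vec using (Vec; []; _∷_; lookup)
open import Data.Vec.Relation.Binary.Pointwise.Inductive as Pointwise using (Pointwise; []; _∷_)
open import Data.Vec.Relation.Unary.All using ([]; _∷_)
open import Data.Vec.Relation.Unary.AllPairs using ([]; _∷_)
open import Data.Vec.Relation.Unary.Unique.Propositional using (Unique)
open import Data.Vec.Relation.Unary.Unique.Propositional.Properties using (lookup-injective)
open import Function using (_∘_; id)
open import Function.Bundles using (mk⇔)
open import Relation.Nullary using (¬_; Dec; yes; no; does; contradiction)
open import Relation.Nullary.Decidable using (dec-true; dec-false; does-⇔; _×-dec_; ¬?)
open import Relation.Binary.PropositionalEquality using (_≡_; _≢_; refl; trans; cong; subst; ≢-sym) renaming (sym to ≡-sym)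

private variable
  m n N Δ r k : ℕ

-- Finite sets and counting

true≢false : true ≢ false
true≢false ()

∧-split : ∀ {a b} → a ∧ b ≡ true → a ≡ true × b ≡ true
∧-split {true} eq = refl , eq

does⇒ : ∀ {a} {A : Set a} (A? : Dec A) → does A? ≡ true → A
does⇒ (yes x) _ = x

bit : Bool → ℕ
bit b = if b then 1 else 0

-- Double counting, by induction on the ground set. The degree condition enters through it:
-- neighbourhoods of a few vertices and some singletons are packed into `m` points with multiplicity
-- at most 1 or 2.
sum-count : (fs : List (Fin n → Bool)) → (∀ i → sum (map (λ f → bit (f i)) fs) ≤ k) → sum (map count fs) ≤ n * k
sum-count {zero}  fs h = ≤-reflexive (none fs)
  where
  none : (fs : List (Fin 0 → Bool)) → sum (map count fs) ≡ 0
  none []       = refl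
  none (f ∷ fs) = none fs
sum-count {suc n} fs h = ≤-trans (≤-reflexive (split fs)) (+-mono-≤ (h zero) (sum-count (map (_∘ suc) fs) (λ i → ≤-trans (≤-reflexive (shift fs i)) (h (suc i)))))
  where
  shift : ∀ fs i → sum (map (λ f → bit (f i)) (map (_∘ suc) fs)) ≡ sum (map (λ f → bit (f (suc i))) fs)
  shift []       i = refl
  shift (f ∷ fs) i = cong (bit (f (suc i)) +_) (shift fs i)
  interchange : ∀ a b c d → (a + b) + (c + d) ≡ (a + c) + (b + d)
  interchange = solve-∀
  split : ∀ fs → sum (map count fs) ≡ sum (map (λ f → bit (f zero)) fs) + sum (map count (map (_∘ suc) fs))
  split []       = refl
  split (f ∷ fs) = trans (cong (count f +_) (split fs)) (interchange (bit (f zero)) _ _ _)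

count-mono-≤ : ∀ {f g : Fin n → Bool} → (∀ x → f x ≡ true → g x ≡ true) → count f ≤ count g
count-mono-≤ {zero}          f⊆g = z≤n
count-mono-≤ {suc n} {f} {g} f⊆g = +-mono-≤ (bit-mono (f⊆g zero)) (count-mono-≤ (f⊆g ∘ suc))
  where
  bit-mono : ∀ {a b} → (a ≡ true → b ≡ true) → bit a ≤ bit b
  bit-mono {false} h = z≤n
  bit-mono {true}  h rewrite h refl = ≤-refl

count-mono-< : ∀ {f g : Fin n → Bool} → (∀ x → f x ≡ true → g x ≡ true) →
  ∀ y → f y ≡ false → g y ≡ true → count f < count g
count-mono-< {suc n} {f} {g} f⊆g zero    fy gy rewrite fy | gy = s≤s (count-mono-≤ (f⊆g ∘ suc))
count-mono-< {suc n} {f} {g} f⊆g (suc y) fy gy with f zero | g zero | f⊆g zero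
... | false | false | _ = count-mono-< (f⊆g ∘ suc) y fy gy
... | false | true  | _ = s≤s (count-mono-≤ (f⊆g ∘ suc))
... | true  | true  | _ = s≤s (count-mono-< (f⊆g ∘ suc) y fy gy)
... | true  | false | h = contradiction (≡-sym (h refl)) true≢false

count-positive : ∀ {f : Fin n → Bool} y → f y ≡ true → 1 ≤ count f
count-positive y fy = ≤-trans (s≤s z≤n) (count-mono-< {f = λ _ → false} (λ _ ()) y refl fy)

record Enumeration (f : Fin n → Bool) (k : ℕ) : Set where
  field
    at        : Fin k → Fin n
    at-true   : ∀ i → f (at i) ≡ true
    injective : ∀ {i j} → at i ≡ at j → i ≡ j
    index     : ∀ {x} → f x ≡ true → ∃ λ i → at i ≡ x

enumerate : (f : Fin n → Bool) → Enumeration f (count f)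
enumerate {zero}  f = record { at = λ () ; at-true = λ () ; injective = λ { {()} } ; index = λ { {()} } }
enumerate {suc n} f with f zero in f0 | enumerate (f ∘ suc)
... | false | e = record
  { at = suc ∘ at ; at-true = at-true ; injective = injective ∘ suc-injective ; index = idx }
  where
  open Enumeration e
  idx : ∀ {x} → f x ≡ true → ∃ λ i → suc (at i) ≡ x
  idx {zero}  fx = contradiction (trans (≡-sym fx) f0) true≢false
  idx {suc x} fx with i , eq ← index fx = i , cong suc eq
... | true | e = record { at = at′ ; at-true = at′-true ; injective = inj ; index = idx }
  where
  open Enumeration e
  at′ : Fin (suc (count (f ∘ suc))) → Fin (suc n)
  at′ zero    = zero
  at′ (suc i) = suc (at i)
  at′-true : ∀ i → f (at′ i) ≡ true
  at′-true zero    = f0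
  at′-true (suc i) = at-true i
  inj : ∀ {i j} → at′ i ≡ at′ j → i ≡ j
  inj {zero}  {zero}  eq = refl
  inj {zero}  {suc j} ()
  inj {suc i} {zero}  ()
  inj {suc i} {suc j} eq = cong suc (injective (suc-injective eq))
  idx : ∀ {x} → f x ≡ true → ∃ λ i → at′ i ≡ x
  idx {zero}  fx = zero , refl
  idx {suc x} fx with i , eq ← index fx = suc i , cong suc eq

count-injection : ∀ {f : Fin m → Bool} {g : Fin n → Bool} (h : Fin m → Fin n) →
  (∀ x → f x ≡ true → g (h x) ≡ true) →
  (∀ x y → f x ≡ true → f y ≡ true → h x ≡ h y → x ≡ y) → count f ≤ count g
count-injection {f = f} {g} h pres inj = injective⇒≤ {f = λ i → proj₁ (G.index (pres _ (F.at-true i)))} λ {i} {j} eq →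
  F.injective (inj _ _ (F.at-true i) (F.at-true j)
    (trans (≡-sym (proj₂ (G.index (pres _ (F.at-true i))))) (trans (cong G.at eq) (proj₂ (G.index (pres _ (F.at-true j)))))))
  where
  module F = Enumeration (enumerate f)
  module G = Enumeration (enumerate g)

-- A missed value `y` could be punched out of the codomain, leaving an injection into a smaller set.
injective⇒hits : ∀ (f : Fin n → Fin n) → (∀ {i j} → f i ≡ f j → i ≡ j) → ∀ y → ∃ λ i → f i ≡ y
injective⇒hits {suc n} f inj y with any? (λ i → f i ≟ y)
... | yes hit = hit
... | no miss = contradiction (injective⇒≤ {f = λ i → punchOut (avoid i)} λ {i} {j} eq → inj (punchOut-injective (avoid i) (avoid j) eq)) 1+n≰n
  where
  avoid : ∀ i → y ≢ f i
  avoid i eq = miss (i , ≡-sym eq)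

-- Alternating chains of two involutions

Involution : (Fin n → Fin n) → Set
Involution σ = ∀ x → σ (σ x) ≡ x

-- Encoded as a set of vertices instead of a sequence: for a Kempe exchange the set must be closed
-- under both matchings, and only `p` and `q` may be points of it that one of the matchings fixes.
record Chain (σ τ : Fin n → Fin n) (p q : Fin n) : Set where
  field
    on      : Fin n → Bool
    p∈      : on p ≡ true
    q∈      : on q ≡ true
    closedˡ : ∀ x → on x ≡ true → on (σ x) ≡ true
    closedʳ : ∀ x → on x ≡ true → on (τ x) ≡ true
    fixedˡ  : ∀ x → on x ≡ true → σ x ≡ x → x ≡ p ⊎ x ≡ q
    fixedʳ  : ∀ x → on x ≡ true → τ x ≡ x → x ≡ p ⊎ x ≡ q

Endpoint : (σ τ : Fin n → Fin n) → Fin n → Set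
Endpoint σ τ x = (σ x ≡ x × τ x ≢ x) ⊎ (σ x ≢ x × τ x ≡ x)

OtherEnd : (σ τ : Fin n → Fin n) → Fin n → Set
OtherEnd σ τ p = ∃ λ q → q ≢ p × Endpoint σ τ q × Chain σ τ p q

otherEnd-sym : ∀ {σ τ : Fin n → Fin n} {p} → OtherEnd σ τ p → OtherEnd τ σ p
otherEnd-sym (q , q≢p , ends , c) = q , q≢p , flipEnds ends , record
  { on = on ; p∈ = p∈ ; q∈ = q∈ ; closedˡ = closedʳ ; closedʳ = closedˡ ; fixedˡ = fixedʳ ; fixedʳ = fixedˡ }
  where
  open Chain c
  flipEnds : _ → _
  flipEnds (inj₁ (a , b)) = inj₂ (b , a)
  flipEnds (inj₂ (a , b)) = inj₁ (b , a)

insert : Fin n → (Fin n → Bool) → Fin n → Bool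
insert y S x = S x ∨ does (x ≟ y)

insert-here : ∀ (S : Fin n → Bool) y → insert y S y ≡ true
insert-here S y rewrite dec-true (y ≟ y) refl = ∨-zeroʳ (S y)

insert-there : ∀ {S : Fin n → Bool} {y x} → S x ≡ true → insert y S x ≡ true
insert-there x∈S rewrite x∈S = refl

insert-elim : ∀ {S : Fin n → Bool} {y x} → insert y S x ≡ true → S x ≡ true ⊎ x ≡ y
insert-elim {S = S} {y} {x} eq with S x
... | true  = inj₁ refl
... | false = inj₂ (does⇒ (x ≟ y) eq)

-- The part of the chain visited so far, on arrival at w along τ.
record Walk (σ τ : Fin n → Fin n) (p w : Fin n) (S : Fin n → Bool) : Set where
  field
    p∈S      : S p ≡ true
    w∈S      : S w ≡ true
    τ-closed : ∀ x → S x ≡ true → S (τ x) ≡ true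
    σ-closed : ∀ x → S x ≡ true → x ≢ w → S (σ x) ≡ true × σ x ≢ w
    τ-fixed  : ∀ x → S x ≡ true → τ x ≡ x → x ≡ p
    σ-fixed  : ∀ x → S x ≡ true → x ≢ w → σ x ≡ x → x ≡ p
    w-end    : σ w ≡ w → w ≢ p

-- The walk leaves `w` along `σ`. If `σ` fixes `w`, the other end is found; otherwise `σ w` is new
-- and the walk goes on with `σ` and `τ` interchanged. The fuel bounds the number of unvisited
-- vertices, which drops at each step.
walk-on : ∀ {σ τ : Fin n → Fin n} {p w S} → Involution σ → Involution τ → ∀ fuel → count (not ∘ S) ≤ fuel → Walk σ τ p w S → OtherEnd σ τ p
walk-on {σ = σ} {τ} {p} {w} {S} invσ invτ fuel bound W with σ w ≟ w
... | yes fix = w , w-end fix , inj₁ (fix , λ τw → w-end fix (τ-fixed w w∈S τw)) , record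
  { on = S ; p∈ = p∈S ; q∈ = w∈S ; closedˡ = closed ; closedʳ = τ-closed
  ; fixedˡ = fixed ; fixedʳ = λ x x∈ eq → inj₁ (τ-fixed x x∈ eq) }
  where
  open Walk W
  closed : ∀ x → S x ≡ true → S (σ x) ≡ true
  closed x x∈ with x ≟ w
  ... | yes refl = trans (cong S fix) w∈S
  ... | no x≢w   = proj₁ (σ-closed x x∈ x≢w)
  fixed : ∀ x → S x ≡ true → σ x ≡ x → x ≡ p ⊎ x ≡ w
  fixed x x∈ eq with x ≟ w
  ... | yes x≡w = inj₂ x≡w
  ... | no x≢w  = inj₁ (σ-fixed x x∈ x≢w eq)
... | no σw≢w = continue fuel bound
  where
  open Walk W
  y = σ w
  -- If `y` had been visited, `σ-closed` would keep its `σ`-partner away from `w`, but that partner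
  -- is `w`.
  y∉S : S y ≡ false
  y∉S with S y in eq
  ... | false = refl
  ... | true  = contradiction (invσ w) (proj₂ (σ-closed y eq σw≢w))
  S′ = insert y S
  ∉⇒≢ : ∀ {x} → S x ≡ true → x ≢ y
  ∉⇒≢ x∈ refl = true≢false (trans (≡-sym x∈) y∉S)
  W′ : Walk τ σ p y S′
  W′ = record
    { p∈S = insert-there {S = S} p∈S ; w∈S = insert-here S y ; τ-closed = closed
    ; σ-closed = λ x x∈ x≢y → let x∈S = old x∈ x≢y in insert-there {S = S} (τ-closed x x∈S) , ∉⇒≢ (τ-closed x x∈S)
    ; τ-fixed = fixed
    ; σ-fixed = λ x x∈ x≢y → τ-fixed x (old x∈ x≢y)
    ; w-end = λ _ → ≢-sym (∉⇒≢ p∈S) }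
    where
    old : ∀ {x} → S′ x ≡ true → x ≢ y → S x ≡ true
    old x∈ x≢y with insert-elim {S = S} x∈
    ... | inj₁ x∈S = x∈S
    ... | inj₂ x≡y = contradiction x≡y x≢y
    closed : ∀ x → S′ x ≡ true → S′ (σ x) ≡ true
    closed x x∈ with x ≟ w | insert-elim {S = S} x∈
    ... | yes refl | _         = insert-here S y
    ... | no _     | inj₂ refl = insert-there {S = S} (trans (cong S (invσ w)) w∈S)
    ... | no x≢w   | inj₁ x∈S  = insert-there {S = S} (proj₁ (σ-closed x x∈S x≢w))
    fixed : ∀ x → S′ x ≡ true → σ x ≡ x → x ≡ p
    fixed x x∈ eq with x ≟ w | insert-elim {S = S} x∈
    ... | yes refl | _         = contradiction eq σw≢w
    ... | no x≢w   | inj₂ refl = contradiction (trans (≡-sym eq) (invσ w)) x≢w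
    ... | no x≢w   | inj₁ x∈S  = σ-fixed x x∈S x≢w eq
  shrinks : count (not ∘ S′) < count (not ∘ S)
  shrinks = count-mono-< sub y (cong not (insert-here S y)) (cong not y∉S)
    where
    sub : ∀ x → not (S′ x) ≡ true → not (S x) ≡ true
    sub x h with S x
    ... | false = refl
  continue : ∀ fuel → count (not ∘ S) ≤ fuel → OtherEnd σ τ p
  continue zero       b = contradiction (≤-trans shrinks b) λ ()
  continue (suc fuel) b with s≤s b′ ← ≤-trans shrinks b = otherEnd-sym (walk-on invτ invσ fuel b′ W′)

otherEnd : ∀ {σ τ : Fin n → Fin n} → Involution σ → Involution τ → ∀ {p} → Endpoint σ τ p → OtherEnd σ τ p
otherEnd {n} invσ invτ (inj₁ ends) = otherEnd-sym (otherEnd invτ invσ (inj₂ (proj₂ ends , proj₁ ends)))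
-- The visited set is `p` alone, as if the walk had just arrived along `τ`, which fixes `p`; the
-- first step is then along `σ`.
otherEnd {n} {σ} {τ} invσ invτ {p} (inj₂ (σp≢p , τp≡p)) = walk-on invσ invτ _ ≤-refl record
  { p∈S = singleton p refl ; w∈S = singleton p refl
  ; τ-closed = λ x x∈ → singleton (τ x) (trans (cong τ (only x x∈)) τp≡p)
  ; σ-closed = λ x x∈ x≢p → contradiction (only x x∈) x≢p
  ; τ-fixed = λ x x∈ _ → only x x∈
  ; σ-fixed = λ x x∈ x≢p → contradiction (only x x∈) x≢p
  ; w-end = λ eq → contradiction eq σp≢p }
  where
  S : Fin n → Bool
  S x = does (x ≟ p)
  singleton : ∀ x → x ≡ p → S x ≡ true
  singleton x = dec-true (x ≟ p)
  only : ∀ x → S x ≡ true → x ≡ p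
  only x = does⇒ (x ≟ p)

-- Families of matchings

-- A partial edge colouring is given by one involution per colour: μ c x is the neighbour
-- of x along colour c, and x itself when c is missing at x.
Matchings : ℕ → ℕ → Set
Matchings Δ N = Fin Δ → Fin N → Fin N

Involutive : Matchings Δ N → Set
Involutive μ = ∀ c → Involution (μ c)

missing : Matchings Δ N → Fin Δ → Fin N → Bool
missing μ c x = does (μ c x ≟ x)

SameEdge : (x y p q : Fin N) → Set
SameEdge x y p q = (x ≡ p × y ≡ q) ⊎ (x ≡ q × y ≡ p)

-- Only coverage is demanded: a matching may join non-adjacent vertices, and an edge may lie in
-- several matchings. `matchings⇒colouring` later selects one colour for each edge.
ColourableWithout : ∀ Δ → Graph N → (p q : Fin N) → Set
ColourableWithout Δ G p q = ∃ λ (μ : Matchings Δ _) → Involutive μ × (∀ x y → Adj G x y ≡ true → SameEdge x y p q ⊎ ∃ λ c → μ c x ≡ y)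

adjacent⇒≢ : (G : Graph N) → ∀ {x y} → Adj G x y ≡ true → x ≢ y
adjacent⇒≢ G {x} e refl = true≢false (trans (≡-sym e) (irref G x))

update : Fin Δ → (Fin N → Fin N) → Matchings Δ N → Matchings Δ N
update c f μ c′ = if does (c′ ≟ c) then f else μ c′

update-same : ∀ c f (μ : Matchings Δ N) → update c f μ c ≡ f
update-same c f μ rewrite dec-true (c ≟ c) refl = refl

update-other : ∀ {c c′} f (μ : Matchings Δ N) → c′ ≢ c → update c f μ c′ ≡ μ c′
update-other {c = c} {c′} f μ c′≢c rewrite dec-false (c′ ≟ c) c′≢c = refl

update-involutive : ∀ c f {μ : Matchings Δ N} → Involution f → Involutive μ → Involutive (update c f μ)
update-involutive c f inv-f inv c′ with c′ ≟ c
... | yes _ = inv-f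
... | no _  = inv c′

merge : (Fin N → Bool) → (f g : Fin N → Fin N) → Fin N → Fin N
merge S f g x = if S x then f x else g x

merge-in : ∀ {S : Fin N → Bool} {x} f g → S x ≡ true → merge S f g x ≡ f x
merge-in f g x∈ rewrite x∈ = refl

merge-out : ∀ {S : Fin N → Bool} {x} f g → S x ≡ false → merge S f g x ≡ g x
merge-out f g x∉ rewrite x∉ = refl

closed-under : ∀ {S : Fin N → Bool} {f} → Involution f → (∀ x → S x ≡ true → S (f x) ≡ true) → ∀ x → S (f x) ≡ S x
closed-under {S = S} {f} inv closed x with S x in eq | S (f x) in eq′
... | true  | _     = trans (≡-sym eq′) (closed x eq)
... | false | false = refl
... | false | true  = trans (≡-sym (closed (f x) eq′)) (trans (cong S (inv x)) eq)

merge-involution : ∀ {S : Fin N → Bool} {f g} → Involution f → Involution g →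
  (∀ x → S (f x) ≡ S x) → (∀ x → S (g x) ≡ S x) → Involution (merge S f g)
merge-involution {S = S} {f} {g} inv-f inv-g cf cg x with S x in eq
... | true  rewrite trans (cf x) eq = inv-f x
... | false rewrite trans (cg x) eq = inv-g x

link : (p q : Fin N) → (Fin N → Fin N) → Fin N → Fin N
link p q f x = if does (x ≟ p) then q else if does (x ≟ q) then p else f x

unlink : (p q : Fin N) → (Fin N → Fin N) → Fin N → Fin N
unlink p q f x = if does (x ≟ p) ∨ does (x ≟ q) then x else f x

module _ {p q : Fin N} {f : Fin N → Fin N} where

  link-left : link p q f p ≡ q
  link-left rewrite dec-true (p ≟ p) refl = refl

  link-right : link p q f q ≡ p
  link-right with q ≟ p
  ... | yes q≡p = q≡p
  ... | no _ rewrite dec-true (q ≟ q) refl = refl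

  link-other : ∀ {x} → x ≢ p → x ≢ q → link p q f x ≡ f x
  link-other {x} x≢p x≢q rewrite dec-false (x ≟ p) x≢p | dec-false (x ≟ q) x≢q = refl

  link-involution : Involution f → f p ≡ p → f q ≡ q → Involution (link p q f)
  link-involution inv fp fq x = by-cases (x ≟ p) (x ≟ q)
    where
    by-cases : Dec (x ≡ p) → Dec (x ≡ q) → link p q f (link p q f x) ≡ x
    by-cases (yes refl) _          = trans (cong (link p q f) link-left) link-right
    by-cases (no _)     (yes refl) = trans (cong (link p q f) link-right) link-left
    by-cases (no x≢p)   (no x≢q)   = trans (cong (link p q f) (link-other x≢p x≢q)) (trans
      (link-other (λ eq → x≢p (trans (≡-sym (inv x)) (trans (cong f eq) fp)))
                  (λ eq → x≢q (trans (≡-sym (inv x)) (trans (cong f eq) fq)))) (inv x))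

  unlink-at : ∀ {x} → x ≡ p ⊎ x ≡ q → unlink p q f x ≡ x
  unlink-at (inj₁ refl) rewrite dec-true (p ≟ p) refl = refl
  unlink-at (inj₂ refl) rewrite dec-true (q ≟ q) refl | ∨-zeroʳ (does (q ≟ p)) = refl

  unlink-other : ∀ {x} → x ≢ p → x ≢ q → unlink p q f x ≡ f x
  unlink-other {x} x≢p x≢q rewrite dec-false (x ≟ p) x≢p | dec-false (x ≟ q) x≢q = refl

  unlink-involution : Involution f → f p ≡ q → Involution (unlink p q f)
  unlink-involution inv fp x = by-cases (x ≟ p) (x ≟ q)
    where
    by-cases : Dec (x ≡ p) → Dec (x ≡ q) → unlink p q f (unlink p q f x) ≡ x
    by-cases (yes x≡p) _         = trans (cong (unlink p q f) (unlink-at (inj₁ x≡p))) (unlink-at (inj₁ x≡p))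
    by-cases (no _)    (yes x≡q) = trans (cong (unlink p q f) (unlink-at (inj₂ x≡q))) (unlink-at (inj₂ x≡q))
    by-cases (no x≢p)  (no x≢q)  = trans (cong (unlink p q f) (unlink-other x≢p x≢q)) (trans
      (unlink-other (λ eq → x≢q (trans (≡-sym (inv x)) (trans (cong f eq) fp)))
                    (λ eq → x≢p (trans (≡-sym (inv x)) (trans (cong f (trans eq (≡-sym fp))) (inv p))))) (inv x))

-- The Kempe game

-- The terminals are the vertices missing some named colour; a state records which.  A link
-- (α , β , i , j) says that the (α,β)-chain starting at terminal i ends at terminal j.
State : ℕ → ℕ → Set
State r k = Fin r → Fin k → Bool

Link : ℕ → ℕ → Set
Link r k = Fin k × Fin k × Fin r × Fin r

-- ask α β i branches on the other end of the (α,β)-chain at terminal i, flip exchanges the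
-- colours on a chain that is already known, and fill colours the uncoloured edges in order.
data Strategy (r k : ℕ) : Set where
  fill : List (Fin k) → Strategy r k
  flip : (α β : Fin k) (i j : Fin r) → Strategy r k → Strategy r k
  ask  : (α β : Fin k) (i : Fin r) → List (Fin r × Strategy r k) → Strategy r k

_==_ : Fin r → Fin r → Bool
i == j = does (i ≟ j)

_[_≔_] : State r k → Fin k → (Fin r → Bool) → State r k
(s [ c ≔ row ]) l c′ = if c′ == c then row l else s l c′

oneOf : (i j l : Fin r) → Bool
oneOf i j l = (l == i) ∨ (l == j)

occupy release : Fin r → Fin r → Fin k → State r k → State r k
occupy  i j c s = s [ c ≔ (λ l → if oneOf i j l then false else s l c) ]
release i j c s = s [ c ≔ (λ l → if oneOf i j l then true else s l c) ]

-- Only the rows of the two ends change, because every other vertex of the chain sees both colours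
-- before and after the exchange.
exchange : Fin k → Fin k → Fin r → Fin r → State r k → State r k
exchange α β i j s = (s [ β ≔ (λ l → if oneOf i j l then s l α else s l β) ]) [ α ≔ (λ l → if oneOf i j l then s l β else s l α) ]

-- Exchanging α and β along a chain disturbs neither the (α,β)-chains nor the chains of two
-- colours other than α and β.
survives : Fin k → Fin k → Link r k → Bool
survives α β (γ , δ , _) = ((γ == α) ∧ (δ == β)) ∨ (not (γ == α) ∧ not (γ == β) ∧ not (δ == α) ∧ not (δ == β))

_∈?_ : (l : Link r k) (ls : List (Link r k)) → Dec _
_∈?_ = Membership._∈?_ (≡-dec _≟_ (≡-dec _≟_ (≡-dec _≟_ _≟_)))

fills : State r k → List (Fin r × Fin r) → List (Fin k) → Bool
fills s []            []       = true
fills s ((i , j) ∷ L) (c ∷ cs) = not (i == j) ∧ s i c ∧ s j c ∧ fills (occupy i j c s) L cs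
fills s _             _        = false

-- For `ask`, a winning branch is required at each terminal other than `i` that misses exactly one
-- of the two colours: these are the possible other ends of the chain. For `fill`, the edges of `L`
-- must be used up, each getting a colour missing at both its ends at that moment.
wins   : List (Fin r × Fin r) → State r k → List (Link r k) → Strategy r k → Bool
winsAt : List (Fin r × Fin r) → State r k → List (Link r k) → Fin r → List (Fin r × Strategy r k) → Bool
wins L s ls (fill cs)          = fills s L cs
wins L s ls (flip α β i j st)  = does ((α , β , i , j) ∈? ls) ∧ not (α == β) ∧ wins L (exchange α β i j s) (filterᵇ (survives α β) ls) st
wins L s ls (ask α β i bs)     = (s i α xor s i β) ∧ does (all? λ j →
  ((j == i) ∨ not (s j α xor s j β) ∨ winsAt L s ((α , β , i , j) ∷ ls) j bs) ≟ᵇ true)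
winsAt L s ls j []             = false
winsAt L s ls j ((j′ , st) ∷ bs) = if j == j′ then wins L s ls st else winsAt L s ls j bs

releaseAll : List (Fin r × Fin r × Fin k) → State r k → State r k
releaseAll []                s = s
releaseAll ((i , j , c) ∷ K) s = releaseAll K (release i j c s)

all-true : ∀ {A : Set} → (A → Bool) → List A → Bool
all-true f []       = true
all-true f (x ∷ xs) = f x ∧ all-true f xs

apart : Fin r → Fin r → Fin k → Fin r × Fin r × Fin k → Bool
apart i j c (i′ , _ , c′) = not ((c′ == c) ∧ oneOf i j i′)

-- The edges are released one after another. The `apart` test ensures that a later entry is still
-- coloured when its turn comes, and membership in `L` that a released edge counts among the
-- uncoloured ones.
releasable : List (Fin r × Fin r) → List (Fin r × Fin r × Fin k) → Bool
releasable L []                = true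
releasable L ((i , j , c) ∷ K) = not (i == j) ∧ does (Membership._∈?_ (≡-dec _≟_ _≟_) (i , j) L) ∧ all-true (apart i j c) K ∧ releasable L K

==-refl : (i : Fin r) → (i == i) ≡ true
==-refl i = dec-true (i ≟ i) refl

oneOf-cases : ∀ (i j l : Fin r) → (oneOf i j l ≡ true × (l ≡ i ⊎ l ≡ j)) ⊎ (oneOf i j l ≡ false × l ≢ i × l ≢ j)
oneOf-cases i j l with l ≟ i | l ≟ j
... | yes a | _     = inj₁ (refl , inj₁ a)
... | no a  | yes b = inj₁ (refl , inj₂ b)
... | no a  | no b  = inj₂ (refl , a , b)

not-true : ∀ {b} → not b ≡ true → b ≡ false
not-true {false} _ = refl

≠-true : ∀ {i j : Fin r} → not (i == j) ≡ true → i ≢ j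
≠-true {i = i} h refl = true≢false (trans (≡-sym h) (cong not (==-refl i)))

xor-cases : ∀ {a b} → a xor b ≡ true → (a ≡ true × b ≡ false) ⊎ (a ≡ false × b ≡ true)
xor-cases {true}  {false} _ = inj₁ (refl , refl)
xor-cases {false} {true}  _ = inj₂ (refl , refl)

-- Soundness of the Kempe game

module Game (G : Graph N) (t : Fin r → Fin N) (t-inj : ∀ {i j} → t i ≡ t j → i ≡ j)
            (κ : Fin k → Fin Δ) (κ-inj : ∀ {c d} → κ c ≡ κ d → c ≡ d) where

  -- The field `full` keeps the game on the terminals: a vertex missing a named colour is a
  -- terminal, so a chain of two named colours that starts at a terminal also ends at one.
  record Realises (μ : Matchings Δ N) (s : State r k) : Set where
    field
      agrees : ∀ l c → missing μ (κ c) (t l) ≡ s l c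
      full   : ∀ c x → μ (κ c) x ≡ x → ∃ λ l → x ≡ t l
  open Realises

  Covers : Matchings Δ N → List (Fin r × Fin r) → Set
  Covers μ L = ∀ x y → Adj G x y ≡ true → Any (λ (i , j) → SameEdge x y (t i) (t j)) L ⊎ ∃ λ c → μ c x ≡ y

  Linked : Matchings Δ N → Link r k → Set
  Linked μ (α , β , i , j) = Chain (μ (κ α)) (μ (κ β)) (t i) (t j)

  realises-update : ∀ {μ s c f row} → Realises μ s → (∀ l → does (f (t l) ≟ t l) ≡ row l) →
    (∀ x → f x ≡ x → ∃ λ l → x ≡ t l) → Realises (update (κ c) f μ) (s [ c ≔ row ])
  realises-update {μ} {s} {c} {f} {row} R rows f-full = record { agrees = agrees′ ; full = full′ }
    where
    agrees′ : ∀ l c′ → missing (update (κ c) f μ) (κ c′) (t l) ≡ (s [ c ≔ row ]) l c′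
    agrees′ l c′ with c′ ≟ c
    ... | yes refl rewrite update-same (κ c) f μ = rows l
    ... | no c′≢c rewrite update-other f μ (c′≢c ∘ κ-inj) = agrees R l c′
    full′ : ∀ c′ x → update (κ c) f μ (κ c′) x ≡ x → ∃ λ l → x ≡ t l
    full′ c′ x eq with c′ ≟ c
    ... | yes refl rewrite update-same (κ c) f μ = f-full x eq
    ... | no c′≢c rewrite update-other f μ (c′≢c ∘ κ-inj) = full R c′ x eq

  fixed : ∀ {μ s l c} → Realises μ s → s l c ≡ true → μ (κ c) (t l) ≡ t l
  fixed {l = l} {c} R eq = does⇒ (_ ≟ _) (trans (agrees R l c) eq)

  moved : ∀ {μ s l c} → Realises μ s → s l c ≡ false → μ (κ c) (t l) ≢ t l
  moved {l = l} {c} R eq fix = true≢false (trans (≡-sym (dec-true (_ ≟ _) fix)) (trans (agrees R l c) eq))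

  terminal : ∀ {i j l} → t l ≡ t i ⊎ t l ≡ t j → l ≡ i ⊎ l ≡ j
  terminal (inj₁ eq) = inj₁ (t-inj eq)
  terminal (inj₂ eq) = inj₂ (t-inj eq)

  realises-occupy : ∀ {μ s i j c} → Realises μ s → i ≢ j →
    Realises (update (κ c) (link (t i) (t j) (μ (κ c))) μ) (occupy i j c s)
  realises-occupy {μ} {s} {i} {j} {c} R i≢j = realises-update R rows f-full
    where
    f = link (t i) (t j) (μ (κ c))
    rows : ∀ l → does (f (t l) ≟ t l) ≡ (if oneOf i j l then false else s l c)
    rows l with oneOf-cases i j l
    ... | inj₁ (eq , inj₁ refl) rewrite eq | link-left {p = t i} {t j} {μ (κ c)} = dec-false (_ ≟ _) (i≢j ∘ ≡-sym ∘ t-inj)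
    ... | inj₁ (eq , inj₂ refl) rewrite eq | link-right {p = t i} {t j} {μ (κ c)} = dec-false (_ ≟ _) (i≢j ∘ t-inj)
    ... | inj₂ (eq , l≢i , l≢j) rewrite eq | link-other {p = t i} {t j} {μ (κ c)} (l≢i ∘ t-inj) (l≢j ∘ t-inj) = agrees R l c
    f-full : ∀ x → f x ≡ x → ∃ λ l → x ≡ t l
    f-full x eq with x ≟ t i | x ≟ t j
    ... | yes x≡ | _      = i , x≡
    ... | no _   | yes x≡ = j , x≡
    ... | no _   | no _   = full R c x eq

  realises-release : ∀ {μ s i j c} → Realises μ s →
    Realises (update (κ c) (unlink (t i) (t j) (μ (κ c))) μ) (release i j c s)
  realises-release {μ} {s} {i} {j} {c} R = realises-update R rows f-full
    where
    f = unlink (t i) (t j) (μ (κ c))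
    rows : ∀ l → does (f (t l) ≟ t l) ≡ (if oneOf i j l then true else s l c)
    rows l with oneOf-cases i j l
    ... | inj₁ (eq , inj₁ refl) rewrite eq = dec-true (f (t l) ≟ t l) (unlink-at {p = t i} {t j} {μ (κ c)} (inj₁ refl))
    ... | inj₁ (eq , inj₂ refl) rewrite eq = dec-true (f (t l) ≟ t l) (unlink-at {p = t i} {t j} {μ (κ c)} (inj₂ refl))
    ... | inj₂ (eq , l≢i , l≢j) rewrite eq | unlink-other {p = t i} {t j} {μ (κ c)} (l≢i ∘ t-inj) (l≢j ∘ t-inj) = agrees R l c
    f-full : ∀ x → f x ≡ x → ∃ λ l → x ≡ t l
    f-full x eq with x ≟ t i | x ≟ t j
    ... | yes x≡ | _      = i , x≡
    ... | no _   | yes x≡ = j , x≡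
    ... | no _   | no _   = full R c x eq

  -- No edge loses its colour, since `c` was missing at `t i` and `t j`: an edge already coloured
  -- `c` avoids these two vertices.
  covers-link : ∀ {μ i j c L} → μ c (t i) ≡ t i → μ c (t j) ≡ t j →
    Covers μ ((i , j) ∷ L) → Covers (update c (link (t i) (t j) (μ c)) μ) L
  covers-link {μ} {i} {j} {c} fi fj cov x y e with cov x y e
  ... | inj₁ (there x∈) = inj₁ x∈
  ... | inj₁ (here (inj₁ (refl , refl))) = inj₂ (c , trans (cong (λ h → h x) (update-same c _ μ)) (link-left {p = t i} {t j} {μ c}))
  ... | inj₁ (here (inj₂ (refl , refl))) = inj₂ (c , trans (cong (λ h → h x) (update-same c _ μ)) (link-right {p = t i} {t j} {μ c}))
  ... | inj₂ (c′ , eq) with c′ ≟ c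
  ...   | no c′≢c = inj₂ (c′ , trans (cong (λ h → h x) (update-other _ μ c′≢c)) eq)
  ...   | yes refl = inj₂ (c , trans (cong (λ h → h x) (update-same c _ μ)) (trans (link-other {f = μ c} (off fi) (off fj)) eq))
    where
    off : ∀ {p} → μ c p ≡ p → x ≢ p
    off fp refl = adjacent⇒≢ G e (trans (≡-sym fp) eq)

  covers-unlink : ∀ {μ i j c L} → Involutive μ → (i , j) ∈ L → μ c (t i) ≡ t j →
    Covers μ L → Covers (update c (unlink (t i) (t j) (μ c)) μ) L
  covers-unlink {μ} {i} {j} {c} {L} inv ij∈L fi cov x y e with cov x y e
  ... | inj₁ x∈ = inj₁ x∈
  ... | inj₂ (c′ , eq) with c′ ≟ c
  ...   | no c′≢c = inj₂ (c′ , trans (cong (λ h → h x) (update-other _ μ c′≢c)) eq)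
  ...   | yes refl with x ≟ t i | x ≟ t j
  ...     | yes refl | _ = inj₁ (lose ij∈L (inj₁ (refl , trans (≡-sym eq) fi)))
  ...     | no _ | yes refl = inj₁ (lose ij∈L (inj₂ (refl , trans (≡-sym eq) (trans (cong (μ c) (≡-sym fi)) (inv c _)))))
  ...     | no x≢i | no x≢j = inj₂ (c , trans (cong (λ h → h x) (update-same c _ μ)) (trans (unlink-other {f = μ c} x≢i x≢j) eq))

  fill-sound : ∀ {f μ} L s cs → fills s L cs ≡ true → Involutive μ → Realises μ s → Covers μ (L ++ [ f ]) →
    ∃ λ μ′ → Involutive μ′ × Covers μ′ [ f ]
  fill-sound []            s []       ok inv R cov = _ , inv , cov
  fill-sound {μ = μ} ((i , j) ∷ L) s (c ∷ cs) ok inv R cov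
    with i≢j , ok₁ ← ∧-split {not (i == j)} ok
    with si , ok₂ ← ∧-split {s i c} ok₁
    with sj , ok₃ ← ∧-split {s j c} ok₂
    = fill-sound L (occupy i j c s) cs ok₃
        (update-involutive (κ c) _ (link-involution (inv (κ c)) (fixed R si) (fixed R sj)) inv)
        (realises-occupy R (≠-true i≢j)) (covers-link (fixed R si) (fixed R sj) cov)

  module Swap {μ : Matchings Δ N} (inv : Involutive μ) {α β : Fin k} (α≢β : α ≢ β) {i j : Fin r}
              (chain : Linked μ (α , β , i , j)) where
    open Chain chain using (on; p∈; q∈; closedˡ; closedʳ; fixedˡ; fixedʳ)

    a b : Fin Δ
    a = κ α
    b = κ β

    -- Both merges are formed from the original `μ`, so the two updates together are a simultaneous
    -- exchange of the colours on `on`.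
    μ₁ μ₂ : Matchings Δ N
    μ₁ = update b (merge on (μ a) (μ b)) μ
    μ₂ = update a (merge on (μ b) (μ a)) μ₁

    a≢b : a ≢ b
    a≢b = α≢β ∘ κ-inj

    at-a : μ₂ a ≡ merge on (μ b) (μ a)
    at-a = update-same a _ μ₁

    at-b : μ₂ b ≡ merge on (μ a) (μ b)
    at-b = trans (update-other _ μ₁ (≢-sym a≢b)) (update-same b _ μ)

    elsewhere : ∀ {c} → c ≢ a → c ≢ b → μ₂ c ≡ μ c
    elsewhere c≢a c≢b = trans (update-other _ μ₁ c≢a) (update-other _ μ c≢b)

    involutive : Involutive μ₂
    involutive = update-involutive a _ (merge-involution (inv b) (inv a) cb ca)
                   (update-involutive b _ (merge-involution (inv a) (inv b) ca cb) inv)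
      where
      ca = closed-under {S = on} (inv a) closedˡ
      cb = closed-under {S = on} (inv b) closedʳ

    realises : ∀ {s} → Realises μ s → Realises μ₂ (exchange α β i j s)
    realises {s} R = realises-update (realises-update R rows-b (λ x → merge-full x)) rows-a (λ x → merge-full′ x)
      where
      merge-full : ∀ x → merge on (μ a) (μ b) x ≡ x → ∃ λ l → x ≡ t l
      merge-full x eq with on x
      ... | true  = full R α x eq
      ... | false = full R β x eq
      merge-full′ : ∀ x → merge on (μ b) (μ a) x ≡ x → ∃ λ l → x ≡ t l
      merge-full′ x eq with on x
      ... | true  = full R β x eq
      ... | false = full R α x eq
      unfixed : ∀ {l c} → ¬ (μ (κ c) (t l) ≡ t l) → s l c ≡ false
      unfixed {l} {c} h = trans (≡-sym (agrees R l c)) (dec-false (_ ≟ _) h)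
      ends : ∀ {l} → l ≡ i ⊎ l ≡ j → on (t l) ≡ true
      ends (inj₁ refl) = p∈
      ends (inj₂ refl) = q∈
      -- A terminal on the chain that is neither end is fixed by neither matching, so the exchange
      -- leaves its row as it was.
      inner : ∀ {l} → l ≢ i → l ≢ j → on (t l) ≡ true → s l α ≡ s l β
      inner l≢i l≢j l∈ = trans (unfixed λ eq → [ l≢i , l≢j ]′ (terminal (fixedˡ _ l∈ eq)))
                               (≡-sym (unfixed λ eq → [ l≢i , l≢j ]′ (terminal (fixedʳ _ l∈ eq))))
      rows-b : ∀ l → does (merge on (μ a) (μ b) (t l) ≟ t l) ≡ (if oneOf i j l then s l α else s l β)
      rows-b l with oneOf-cases i j l
      ... | inj₁ (eq , l∈) rewrite eq | ends l∈ = agrees R l α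
      ... | inj₂ (eq , l≢i , l≢j) rewrite eq with on (t l) in l∈
      ...   | true  = trans (agrees R l α) (inner l≢i l≢j l∈)
      ...   | false = agrees R l β
      rows-a : ∀ l → does (merge on (μ b) (μ a) (t l) ≟ t l) ≡ (if oneOf i j l then s l β else s l α)
      rows-a l with oneOf-cases i j l
      ... | inj₁ (eq , l∈) rewrite eq | ends l∈ = agrees R l β
      ... | inj₂ (eq , l≢i , l≢j) rewrite eq with on (t l) in l∈
      ...   | true  = trans (agrees R l β) (≡-sym (inner l≢i l≢j l∈))
      ...   | false = agrees R l α

    covers : ∀ {L} → Covers μ L → Covers μ₂ L
    covers cov x y e with cov x y e
    ... | inj₁ x∈ = inj₁ x∈
    ... | inj₂ (c , eq) = inj₂ (recolour c eq)
      where
      recolour : ∀ c → μ c x ≡ y → ∃ λ c → μ₂ c x ≡ y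
      recolour c eq with c ≟ a | c ≟ b | on x in x∈
      ... | yes refl | _        | true  = b , trans (cong (λ h → h x) at-b) (trans (merge-in {S = on} (μ a) (μ b) x∈) eq)
      ... | yes refl | _        | false = a , trans (cong (λ h → h x) at-a) (trans (merge-out {S = on} (μ b) (μ a) x∈) eq)
      ... | no _     | yes refl | true  = a , trans (cong (λ h → h x) at-a) (trans (merge-in {S = on} (μ b) (μ a) x∈) eq)
      ... | no _     | yes refl | false = b , trans (cong (λ h → h x) at-b) (trans (merge-out {S = on} (μ a) (μ b) x∈) eq)
      ... | no c≢a   | no c≢b   | _     = c , trans (cong (λ h → h x) (elsewhere c≢a c≢b)) eq

    linked : ∀ l → survives α β l ≡ true → Linked μ l → Linked μ₂ l
    linked (γ , δ , i′ , j′) ok C with γ ≟ α | δ ≟ β | γ ≟ β | δ ≟ α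
    -- At each vertex the new partners along `α` and `β` are the old ones in one of the two orders,
    -- so closure and the possible ends are inherited.
    ... | yes refl | yes refl | _ | _ = record
      { on = C.on ; p∈ = C.p∈ ; q∈ = C.q∈
      ; closedˡ = λ x x∈ → trans (cong (λ h → C.on (h x)) at-a) (closed-merge C.closedʳ C.closedˡ x x∈)
      ; closedʳ = λ x x∈ → trans (cong (λ h → C.on (h x)) at-b) (closed-merge C.closedˡ C.closedʳ x x∈)
      ; fixedˡ = λ x x∈ eq → fixed-merge C.fixedʳ C.fixedˡ x x∈ (trans (≡-sym (cong (λ h → h x) at-a)) eq)
      ; fixedʳ = λ x x∈ eq → fixed-merge C.fixedˡ C.fixedʳ x x∈ (trans (≡-sym (cong (λ h → h x) at-b)) eq) }
      where
      module C = Chain C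
      closed-merge : ∀ {f g : Fin N → Fin N} → (∀ x → C.on x ≡ true → C.on (f x) ≡ true) → (∀ x → C.on x ≡ true → C.on (g x) ≡ true) →
        ∀ x → C.on x ≡ true → C.on (merge on f g x) ≡ true
      closed-merge cf cg x x∈ with on x
      ... | true  = cf x x∈
      ... | false = cg x x∈
      fixed-merge : ∀ {f g : Fin N → Fin N} {P : Fin N → Set} → (∀ x → C.on x ≡ true → f x ≡ x → P x) → (∀ x → C.on x ≡ true → g x ≡ x → P x) →
        ∀ x → C.on x ≡ true → merge on f g x ≡ x → P x
      fixed-merge ff fg x x∈ eq with on x
      ... | true  = ff x x∈ eq
      ... | false = fg x x∈ eq
    ... | no γ≢α | no δ≢β | no γ≢β | no δ≢α
      rewrite elsewhere (γ≢α ∘ κ-inj) (γ≢β ∘ κ-inj) | elsewhere (δ≢α ∘ κ-inj) (δ≢β ∘ κ-inj) = C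

  all-filter : ∀ {P Q : Link r k → Set} (keep : Link r k → Bool) → (∀ l → keep l ≡ true → P l → Q l) →
    ∀ ls → All P ls → All Q (filterᵇ keep ls)
  all-filter keep h []       []       = []
  all-filter keep h (l ∷ ls) (p ∷ ps) with keep l in eq
  ... | true  = h l eq p ∷ all-filter keep h ls ps
  ... | false = all-filter keep h ls ps

  -- Induction on the strategy. Throughout, the matchings realise the state, the recorded links are
  -- true chains, and the edges without a colour are among `L` and `f`; the final `fill` leaves only
  -- `f`.
  play   : ∀ {f L μ} s ls st → wins L s ls st ≡ true → Involutive μ → Realises μ s → All (Linked μ) ls →
    Covers μ (L ++ [ f ]) → ∃ λ μ′ → Involutive μ′ × Covers μ′ [ f ]
  playAt : ∀ {f L μ} s ls j bs → winsAt L s ls j bs ≡ true → Involutive μ → Realises μ s → All (Linked μ) ls →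
    Covers μ (L ++ [ f ]) → ∃ λ μ′ → Involutive μ′ × Covers μ′ [ f ]
  play {L = L} s ls (fill cs) ok inv R chains cov = fill-sound L s cs ok inv R cov
  play {μ = μ} s ls (flip α β i j st) ok inv R chains cov
    with known , ok₁ ← ∧-split {does ((α , β , i , j) ∈? ls)} ok
    with distinct , ok₂ ← ∧-split {not (α == β)} ok₁
    = play (exchange α β i j s) _ st ok₂ involutive (realises R) (all-filter (survives α β) linked ls chains) (covers cov)
    where open Swap {μ} inv {α} {β} (≠-true distinct) {i} {j} (lookupAll chains (does⇒ (_ ∈? ls) known))
  play {L = L} {μ} s ls (ask α β i bs) ok inv R chains cov
    with end , ok₁ ← ∧-split {s i α xor s i β} ok
    with otherEnd (inv (κ α)) (inv (κ β)) (endpoint (xor-cases end))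
    where
    endpoint : ∀ {l} → (s l α ≡ true × s l β ≡ false) ⊎ (s l α ≡ false × s l β ≡ true) → Endpoint (μ (κ α)) (μ (κ β)) (t l)
    endpoint (inj₁ (x , y)) = inj₁ (fixed R x , moved R y)
    endpoint (inj₂ (x , y)) = inj₂ (moved R x , fixed R y)
  -- The other end misses one of the two colours, so `full` identifies it as a terminal `j`, and the
  -- branch for `j` is followed.
  ... | q , q≢ , ends , chain with named ends
    where
    named : Endpoint (μ (κ α)) (μ (κ β)) q → ∃ λ j → q ≡ t j
    named (inj₁ (x , _)) = full R α q x
    named (inj₂ (_ , y)) = full R β q y
  ... | j , refl = playAt s _ j bs (valid (does⇒ (all? _) ok₁ j)) inv R (chain ∷ chains) cov
    where
    other : (j == i) ≡ false
    other = dec-false (j ≟ i) (q≢ ∘ cong t)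
    value : ∀ {l c} b → (b ≡ true → μ (κ c) (t l) ≡ t l) → (b ≡ false → μ (κ c) (t l) ≢ t l) → s l c ≡ b
    value {l} {c} true  yes′ no′ = trans (≡-sym (agrees R l c)) (dec-true (_ ≟ _) (yes′ refl))
    value {l} {c} false yes′ no′ = trans (≡-sym (agrees R l c)) (dec-false (_ ≟ _) (no′ refl))
    isEnd : Endpoint (μ (κ α)) (μ (κ β)) (t j) → s j α xor s j β ≡ true
    isEnd (inj₁ (x , y)) rewrite value {j} {α} true (λ _ → x) (λ ()) | value {j} {β} false (λ ()) (λ _ → y) = refl
    isEnd (inj₂ (x , y)) rewrite value {j} {α} false (λ ()) (λ _ → x) | value {j} {β} true (λ _ → y) (λ ()) = refl
    valid : (j == i) ∨ not (s j α xor s j β) ∨ winsAt L s ((α , β , i , j) ∷ ls) j bs ≡ true → winsAt L s ((α , β , i , j) ∷ ls) j bs ≡ true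
    valid h rewrite other | isEnd ends = h
  playAt s ls j ((j′ , st) ∷ bs) ok inv R chains cov with j == j′
  ... | true  = play s ls st ok inv R chains cov
  ... | false = playAt s ls j bs ok inv R chains cov

  Coloured : Matchings Δ N → Fin r × Fin r × Fin k → Set
  Coloured μ (i , j , c) = μ (κ c) (t i) ≡ t j

  uncolour : ∀ {L μ} s K → releasable L K ≡ true → Involutive μ → Realises μ s → All (Coloured μ) K → Covers μ L →
    ∃ λ μ′ → Involutive μ′ × Realises μ′ (releaseAll K s) × Covers μ′ L
  uncolour s [] ok inv R [] cov = _ , inv , R , cov
  uncolour {L} {μ} s ((i , j , c) ∷ K) ok inv R (e ∷ es) cov
    with i≢j , ok₁ ← ∧-split {not (i == j)} ok
    with ij∈L , ok₂ ← ∧-split {does (Membership._∈?_ (≡-dec _≟_ _≟_) (i , j) L)} ok₁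
    with disjoint , ok₃ ← ∧-split {all-true (apart i j c) K} ok₂
    = uncolour (release i j c s) K ok₃
        (update-involutive (κ c) _ (unlink-involution (inv (κ c)) e) inv) (realises-release R)
        (keep K disjoint es) (covers-unlink inv (does⇒ (Membership._∈?_ (≡-dec _≟_ _≟_) (i , j) L) ij∈L) e cov)
    where
    μ′ = update (κ c) (unlink (t i) (t j) (μ (κ c))) μ
    stays : ∀ i′ j′ c′ → not ((c′ == c) ∧ oneOf i j i′) ≡ true → Coloured μ (i′ , j′ , c′) → Coloured μ′ (i′ , j′ , c′)
    stays i′ j′ c′ ok e′ with c′ ≟ c | oneOf-cases i j i′
    ... | no c′≢c  | _ = trans (cong (λ h → h (t i′)) (update-other _ μ (c′≢c ∘ κ-inj))) e′
    ... | yes refl | inj₂ (_ , l≢i , l≢j) = trans (cong (λ h → h (t i′)) (update-same (κ c) _ μ)) (trans (unlink-other {f = μ (κ c)} (l≢i ∘ t-inj) (l≢j ∘ t-inj)) e′)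
    ... | yes refl | inj₁ (eq , _) rewrite eq = contradiction (≡-sym ok) true≢false
    keep : ∀ K → all-true (apart i j c) K ≡ true → All (Coloured μ) K → All (Coloured μ′) K
    keep []                   ok []       = []
    keep ((i′ , j′ , c′) ∷ K) ok (e ∷ es) with ok₁ , ok₂ ← ∧-split {not ((c′ == c) ∧ oneOf i j i′)} ok
      = stays i′ j′ c′ ok₁ e ∷ keep K ok₂ es

-- Colourings of a split graph

-- Models the colouring of `G` without the edge `pq` that comes from a `Δ`-colouring of a
-- `Δ`-regular graph: each colour class was a perfect matching, so its edge at the split vertex goes
-- to one of `p` and `q` and the other end misses that colour.
record SplitColouring (Δ : ℕ) (G : Graph N) (p q : Fin N) : Set where
  field
    μ          : Matchings Δ N
    involutive : Involutive μ
    exclusive  : ∀ c → missing μ c q ≡ not (missing μ c p)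
    full       : ∀ c x → μ c x ≡ x → x ≡ p ⊎ x ≡ q
    covers     : ∀ x y → Adj G x y ≡ true → SameEdge x y p q ⊎ ∃ λ c → μ c x ≡ y

swapEnds : ∀ {G : Graph N} {p q} → SplitColouring Δ G p q → SplitColouring Δ G q p
swapEnds S = record
  { μ = μ ; involutive = involutive
  ; exclusive = λ c → ≡-sym (trans (cong not (exclusive c)) (not-involutive _))
  ; full = λ c x eq → [ inj₂ , inj₁ ]′ (full c x eq)
  ; covers = λ x y e → [ inj₁ ∘ [ inj₂ , inj₁ ]′ , inj₂ ]′ (covers x y e) }
  where open SplitColouring S

-- Terminals 0 and 1 are p and q.
initial : Vec Bool k → State (suc (suc r)) k
initial side zero          c = lookup side c
initial side (suc zero)    c = not (lookup side c)
initial side (suc (suc l)) c = false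

-- In the strategies colours and terminals are numbered as in the calls of playSplit below; the
-- trees were found by exhaustive search over the game states.

nearStrategy₁ : Strategy 4 2
nearStrategy₁ = fill (0F ∷ 1F ∷ [])

nearStrategy₂ : Strategy 4 3
nearStrategy₂ = ask 1F 2F 0F
  ( (1F , flip 1F 2F 0F 1F (fill (0F ∷ 2F ∷ [])))
  ∷ (2F , flip 1F 2F 0F 2F (fill (2F ∷ 0F ∷ [])))
  ∷ (3F , flip 1F 2F 0F 3F (fill (0F ∷ 2F ∷ []))) ∷ [])

pathStrategy₁ : Strategy 5 2
pathStrategy₁ = fill (0F ∷ 1F ∷ 0F ∷ [])

pathStrategy₂ : Strategy 5 3
pathStrategy₂ = ask 0F 2F 1F
  ( (2F , flip 0F 2F 1F 2F (fill (2F ∷ 1F ∷ 2F ∷ [])))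
  ∷ (3F , flip 0F 2F 1F 3F (fill (2F ∷ 0F ∷ 1F ∷ [])))
  ∷ (4F , flip 0F 2F 1F 4F (fill (2F ∷ 0F ∷ 1F ∷ []))) ∷ [])

pathStrategy₃ : Strategy 5 4
pathStrategy₃ = ask 2F 3F 0F
  ( (1F , flip 2F 3F 0F 1F (ask 0F 3F 1F
      ( (2F , flip 0F 3F 1F 2F (fill (3F ∷ 1F ∷ 3F ∷ [])))
      ∷ (3F , flip 0F 3F 1F 3F (fill (3F ∷ 0F ∷ 1F ∷ [])))
      ∷ (4F , flip 0F 3F 1F 4F (fill (3F ∷ 0F ∷ 1F ∷ []))) ∷ [])))
  ∷ (3F , flip 2F 3F 0F 3F (fill (3F ∷ 0F ∷ 1F ∷ [])))
  ∷ (4F , flip 2F 3F 0F 4F (fill (3F ∷ 0F ∷ 1F ∷ []))) ∷ [])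

pathStrategy₄ : Strategy 5 4
pathStrategy₄ = ask 1F 3F 0F
  ( (1F , flip 1F 3F 0F 1F (ask 1F 2F 0F
      ( (1F , flip 1F 2F 0F 1F (ask 0F 1F 1F
          ( (2F , flip 0F 1F 1F 2F (fill (1F ∷ 3F ∷ 1F ∷ [])))
          ∷ (3F , flip 0F 1F 1F 3F (fill (1F ∷ 0F ∷ 3F ∷ [])))
          ∷ (4F , flip 0F 1F 1F 4F (fill (1F ∷ 0F ∷ 3F ∷ []))) ∷ [])))
      ∷ (3F , flip 1F 2F 0F 3F (fill (1F ∷ 0F ∷ 3F ∷ [])))
      ∷ (4F , flip 1F 2F 0F 4F (fill (1F ∷ 0F ∷ 3F ∷ []))) ∷ [])))
  ∷ (2F , flip 1F 3F 0F 2F (fill (3F ∷ 0F ∷ 1F ∷ [])))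
  ∷ (4F , flip 1F 3F 0F 4F (fill (3F ∷ 0F ∷ 3F ∷ []))) ∷ [])

pathStrategy₅ : Strategy 5 4
pathStrategy₅ = ask 0F 1F 1F
  ( (2F , flip 0F 1F 1F 2F (ask 0F 3F 0F
      ( (1F , flip 0F 3F 0F 1F (ask 0F 2F 0F
          ( (1F , flip 0F 2F 0F 1F (ask 0F 1F 1F
              ( (2F , flip 0F 1F 1F 2F (fill (0F ∷ 3F ∷ 0F ∷ [])))
              ∷ (3F , flip 0F 1F 1F 3F (fill (0F ∷ 1F ∷ 3F ∷ [])))
              ∷ (4F , flip 0F 1F 1F 4F (fill (0F ∷ 1F ∷ 3F ∷ []))) ∷ [])))
          ∷ (3F , flip 0F 2F 0F 3F (fill (0F ∷ 1F ∷ 3F ∷ [])))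
          ∷ (4F , flip 0F 2F 0F 4F (fill (0F ∷ 1F ∷ 3F ∷ []))) ∷ [])))
      ∷ (2F , flip 0F 3F 0F 2F (fill (3F ∷ 1F ∷ 0F ∷ [])))
      ∷ (4F , flip 0F 3F 0F 4F (fill (3F ∷ 1F ∷ 3F ∷ []))) ∷ [])))
  ∷ (3F , flip 0F 1F 1F 3F (fill (1F ∷ 0F ∷ 3F ∷ [])))
  ∷ (4F , flip 0F 1F 1F 4F (fill (1F ∷ 0F ∷ 3F ∷ []))) ∷ [])

pathStrategy₆ : Strategy 5 5
pathStrategy₆ = ask 1F 4F 0F
  ( (1F , flip 1F 4F 0F 1F (ask 3F 4F 0F
      ( (1F , flip 3F 4F 0F 1F (ask 2F 4F 0F
          ( (1F , flip 2F 4F 0F 1F (ask 0F 4F 1F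
              ( (2F , flip 0F 4F 1F 2F (fill (4F ∷ 3F ∷ 4F ∷ [])))
              ∷ (3F , flip 0F 4F 1F 3F (fill (4F ∷ 0F ∷ 3F ∷ [])))
              ∷ (4F , flip 0F 4F 1F 4F (fill (4F ∷ 0F ∷ 3F ∷ []))) ∷ [])))
          ∷ (3F , flip 2F 4F 0F 3F (fill (4F ∷ 0F ∷ 3F ∷ [])))
          ∷ (4F , flip 2F 4F 0F 4F (fill (4F ∷ 0F ∷ 3F ∷ []))) ∷ [])))
      ∷ (2F , flip 3F 4F 0F 2F (fill (3F ∷ 0F ∷ 4F ∷ [])))
      ∷ (4F , flip 3F 4F 0F 4F (fill (3F ∷ 0F ∷ 3F ∷ []))) ∷ [])))
  ∷ (3F , flip 1F 4F 0F 3F (fill (4F ∷ 0F ∷ 3F ∷ [])))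
  ∷ (4F , flip 1F 4F 0F 4F (fill (4F ∷ 0F ∷ 3F ∷ []))) ∷ [])

kiteStrategy₁ : Strategy 6 3
kiteStrategy₁ = fill (1F ∷ 0F ∷ 0F ∷ 2F ∷ 1F ∷ [])

kiteStrategy₂ : Strategy 6 3
kiteStrategy₂ = fill (0F ∷ 2F ∷ 1F ∷ 0F ∷ 2F ∷ [])

kiteStrategy₃ : Strategy 6 4
kiteStrategy₃ = ask 1F 3F 0F
  ( (3F , flip 1F 3F 0F 3F (fill (3F ∷ 0F ∷ 0F ∷ 2F ∷ 3F ∷ [])))
  ∷ (4F , flip 1F 3F 0F 4F (fill (3F ∷ 0F ∷ 0F ∷ 2F ∷ 1F ∷ [])))
  ∷ (5F , flip 1F 3F 0F 5F (ask 0F 1F 0F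
      ( (2F , flip 0F 1F 0F 2F (fill (3F ∷ 1F ∷ 1F ∷ 2F ∷ 0F ∷ [])))
      ∷ (4F , flip 0F 1F 0F 4F (ask 2F 3F 0F
          ( (2F , flip 2F 3F 0F 2F (fill (1F ∷ 3F ∷ 2F ∷ 0F ∷ 1F ∷ [])))
          ∷ (3F , flip 0F 1F 0F 4F (flip 2F 3F 0F 3F (ask 1F 2F 0F
              ( (2F , flip 1F 2F 0F 2F (fill (0F ∷ 1F ∷ 1F ∷ 0F ∷ 3F ∷ [])))
              ∷ (3F , flip 1F 2F 0F 3F (fill (1F ∷ 0F ∷ 0F ∷ 2F ∷ 3F ∷ [])))
              ∷ (5F , flip 1F 2F 0F 5F (fill (0F ∷ 2F ∷ 1F ∷ 0F ∷ 3F ∷ []))) ∷ []))))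
          ∷ (4F , flip 2F 3F 0F 4F (fill (1F ∷ 2F ∷ 2F ∷ 0F ∷ 1F ∷ []))) ∷ [])))
      ∷ (5F , flip 0F 1F 0F 5F (fill (3F ∷ 0F ∷ 1F ∷ 2F ∷ 0F ∷ []))) ∷ []))) ∷ [])

kiteStrategy₄ : Strategy 6 4
kiteStrategy₄ = ask 0F 1F 2F
  ( (3F , flip 0F 1F 2F 3F (ask 1F 3F 0F
      ( (2F , flip 1F 3F 0F 2F (fill (0F ∷ 3F ∷ 3F ∷ 2F ∷ 0F ∷ [])))
      ∷ (3F , flip 1F 3F 0F 3F (ask 0F 2F 0F
          ( (2F , flip 0F 2F 0F 2F (fill (3F ∷ 0F ∷ 2F ∷ 1F ∷ 0F ∷ [])))
          ∷ (4F , flip 0F 2F 0F 4F (flip 1F 3F 0F 3F (ask 0F 1F 0F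
              ( (2F , flip 0F 1F 0F 2F (fill (0F ∷ 2F ∷ 2F ∷ 0F ∷ 3F ∷ [])))
              ∷ (3F , flip 0F 1F 0F 3F (fill (0F ∷ 2F ∷ 2F ∷ 1F ∷ 3F ∷ [])))
              ∷ (5F , flip 0F 1F 0F 5F (fill (2F ∷ 1F ∷ 0F ∷ 2F ∷ 3F ∷ []))) ∷ []))))
          ∷ (5F , flip 0F 2F 0F 5F (fill (3F ∷ 2F ∷ 2F ∷ 1F ∷ 0F ∷ []))) ∷ [])))
      ∷ (4F , flip 1F 3F 0F 4F (fill (0F ∷ 1F ∷ 3F ∷ 2F ∷ 0F ∷ []))) ∷ [])))
  ∷ (4F , flip 0F 1F 2F 4F (fill (0F ∷ 1F ∷ 1F ∷ 2F ∷ 3F ∷ [])))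
  ∷ (5F , flip 0F 1F 2F 5F (fill (0F ∷ 1F ∷ 1F ∷ 2F ∷ 3F ∷ []))) ∷ [])

kiteStrategy₅ : Strategy 6 4
kiteStrategy₅ = ask 0F 3F 0F
  ( (2F , flip 0F 3F 0F 2F (fill (1F ∷ 3F ∷ 3F ∷ 2F ∷ 1F ∷ [])))
  ∷ (3F , flip 0F 3F 0F 3F (ask 1F 2F 0F
      ( (2F , flip 1F 2F 0F 2F (fill (3F ∷ 1F ∷ 2F ∷ 0F ∷ 1F ∷ [])))
      ∷ (4F , flip 0F 3F 0F 3F (flip 1F 2F 0F 4F (ask 0F 1F 0F
          ( (2F , flip 0F 1F 0F 2F (fill (1F ∷ 2F ∷ 2F ∷ 1F ∷ 3F ∷ [])))
          ∷ (3F , flip 0F 1F 0F 3F (fill (1F ∷ 2F ∷ 2F ∷ 0F ∷ 3F ∷ [])))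
          ∷ (5F , flip 0F 1F 0F 5F (fill (2F ∷ 0F ∷ 1F ∷ 2F ∷ 3F ∷ []))) ∷ []))))
      ∷ (5F , flip 1F 2F 0F 5F (fill (3F ∷ 2F ∷ 2F ∷ 0F ∷ 1F ∷ []))) ∷ [])))
  ∷ (4F , flip 0F 3F 0F 4F (fill (1F ∷ 0F ∷ 3F ∷ 2F ∷ 1F ∷ []))) ∷ [])

kiteStrategy₆ : Strategy 6 4
kiteStrategy₆ = ask 0F 3F 0F
  ( (2F , flip 0F 3F 0F 2F (fill (3F ∷ 2F ∷ 1F ∷ 3F ∷ 2F ∷ [])))
  ∷ (3F , flip 0F 3F 0F 3F (fill (3F ∷ 2F ∷ 1F ∷ 0F ∷ 2F ∷ [])))
  ∷ (4F , flip 0F 3F 0F 4F (ask 1F 2F 0F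
      ( (2F , flip 1F 2F 0F 2F (fill (2F ∷ 0F ∷ 3F ∷ 1F ∷ 2F ∷ [])))
      ∷ (4F , flip 1F 2F 0F 4F (fill (2F ∷ 0F ∷ 3F ∷ 2F ∷ 1F ∷ [])))
      ∷ (5F , flip 0F 3F 0F 4F (flip 1F 2F 0F 5F (ask 0F 1F 0F
          ( (2F , flip 0F 1F 0F 2F (fill (1F ∷ 2F ∷ 2F ∷ 1F ∷ 3F ∷ [])))
          ∷ (3F , flip 0F 1F 0F 3F (fill (1F ∷ 2F ∷ 2F ∷ 0F ∷ 3F ∷ [])))
          ∷ (5F , flip 0F 1F 0F 5F (fill (2F ∷ 0F ∷ 1F ∷ 2F ∷ 3F ∷ []))) ∷ [])))) ∷ []))) ∷ [])

kiteStrategy₇ : Strategy 6 5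
kiteStrategy₇ = ask 0F 4F 0F
  ( (2F , flip 0F 4F 0F 2F (ask 1F 4F 2F
      ( (3F , flip 1F 4F 2F 3F (ask 1F 3F 0F
          ( (2F , flip 1F 3F 0F 2F (fill (4F ∷ 3F ∷ 3F ∷ 2F ∷ 4F ∷ [])))
          ∷ (3F , flip 1F 3F 0F 3F (ask 2F 4F 0F
              ( (2F , flip 2F 4F 0F 2F (fill (3F ∷ 4F ∷ 2F ∷ 1F ∷ 4F ∷ [])))
              ∷ (4F , flip 1F 3F 0F 3F (flip 2F 4F 0F 4F (ask 1F 4F 0F
                  ( (2F , flip 1F 4F 0F 2F (fill (2F ∷ 4F ∷ 4F ∷ 2F ∷ 3F ∷ [])))
                  ∷ (3F , flip 1F 4F 0F 3F (fill (4F ∷ 2F ∷ 2F ∷ 1F ∷ 3F ∷ [])))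
                  ∷ (5F , flip 1F 4F 0F 5F (fill (2F ∷ 1F ∷ 4F ∷ 2F ∷ 3F ∷ []))) ∷ []))))
              ∷ (5F , flip 2F 4F 0F 5F (fill (3F ∷ 2F ∷ 2F ∷ 1F ∷ 4F ∷ []))) ∷ [])))
          ∷ (4F , flip 1F 3F 0F 4F (fill (4F ∷ 1F ∷ 3F ∷ 2F ∷ 4F ∷ []))) ∷ [])))
      ∷ (4F , flip 1F 4F 2F 4F (fill (4F ∷ 1F ∷ 1F ∷ 2F ∷ 3F ∷ [])))
      ∷ (5F , flip 1F 4F 2F 5F (fill (4F ∷ 1F ∷ 1F ∷ 2F ∷ 3F ∷ []))) ∷ [])))
  ∷ (4F , flip 0F 4F 0F 4F (fill (4F ∷ 0F ∷ 1F ∷ 2F ∷ 3F ∷ [])))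
  ∷ (5F , flip 0F 4F 0F 5F (fill (4F ∷ 0F ∷ 1F ∷ 2F ∷ 3F ∷ []))) ∷ [])


-- Moving the uncoloured edge away from the split vertex

module _ {G : Graph N} {p q : Fin N} (S : SplitColouring Δ G p q) where
  open SplitColouring S

  MissingAt-p : Fin Δ → Bool → Set
  MissingAt-p c b = missing μ c p ≡ b

  -- The bridge from games to graphs. The edges in `K` are stripped of their colours, `pq` has none
  -- from the start, and the strategy colours `pq` and the edges of `L`, so that `f` alone is left.
  -- At each call below `releasable` and `wins` are closed computations, settled by `refl`.
  playSplit : ∀ {ts : Vec (Fin N) r} (unique : Unique (p ∷ q ∷ ts)) {cs : Vec (Fin Δ) k} → Unique cs →
    {side : Vec Bool k} → Pointwise MissingAt-p cs side →
    (K : List (Fin (suc (suc r)) × Fin (suc (suc r)) × Fin k)) →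
    All (λ (i , j , c) → μ (lookup cs c) (lookup (p ∷ q ∷ ts) i) ≡ lookup (p ∷ q ∷ ts) j) K →
    (L : List (Fin (suc (suc r)) × Fin (suc (suc r)))) (f : Fin (suc (suc r)) × Fin (suc (suc r))) →
    releasable ((0F , 1F) ∷ L ++ [ f ]) K ≡ true →
    (st : Strategy (suc (suc r)) k) → wins ((0F , 1F) ∷ L) (releaseAll K (initial side)) [] st ≡ true →
    ColourableWithout Δ G (lookup (p ∷ q ∷ ts) (proj₁ f)) (lookup (p ∷ q ∷ ts) (proj₂ f))
  playSplit {r} {k} {ts = ts} unique {cs} unique-cs {side} sides K edges L f rel st win
    = result
    where
    t = lookup (p ∷ q ∷ ts)
    t-inj : ∀ {i j} → t i ≡ t j → i ≡ j
    t-inj = lookup-injective unique _ _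
    open Game G t t-inj (lookup cs) (lookup-injective unique-cs _ _)
    start : Realises μ (initial side)
    start = record { agrees = agrees ; full = full′ }
      where
      agrees : ∀ l c → missing μ (lookup cs c) (t l) ≡ initial side l c
      agrees zero          c = Pointwise.lookup sides c
      agrees (suc zero)    c = trans (exclusive _) (cong not (Pointwise.lookup sides c))
      agrees (suc (suc l)) c = dec-false (_ ≟ _) λ eq → [ (λ e → absurd₀ (t-inj {suc (suc l)} {0F} e)) , (λ e → absurd₁ (t-inj {suc (suc l)} {1F} e)) ]′ (full _ _ eq)
        where
        absurd₀ : suc (suc l) ≢ 0F
        absurd₀ ()
        absurd₁ : suc (suc l) ≢ 1F
        absurd₁ ()
      full′ : ∀ c x → μ (lookup cs c) x ≡ x → ∃ λ l → x ≡ t l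
      full′ c x eq = [ (0F ,_) , (1F ,_) ]′ (full _ x eq)
    result : ColourableWithout Δ G (t (proj₁ f)) (t (proj₂ f))
    result
      with μ₁ , inv₁ , R₁ , cov₁ ← uncolour (initial side) K rel involutive start edges (λ x y e → [ inj₁ ∘ here , inj₂ ]′ (covers x y e))
      with μ₂ , inv₂ , cov₂ ← play {f = f} {(0F , 1F) ∷ L} (releaseAll K (initial side)) [] st win inv₁ R₁ [] cov₁
      = μ₂ , inv₂ , λ x y e → [ (λ { (here se) → inj₁ se }) , inj₂ ]′ (cov₂ x y e)

  colour : ∀ {x y} → Adj G x y ≡ true → ¬ SameEdge x y p q → ∃ λ c → μ c x ≡ y
  colour e ≠pq = [ (λ se → contradiction se ≠pq) , (λ h → h) ]′ (covers _ _ e)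

  reverse : ∀ {c x y} → μ c x ≡ y → μ c y ≡ x
  reverse {c} refl = involutive c _

  colours≢ : ∀ {c d x y z} → μ c x ≡ y → μ d x ≡ z → y ≢ z → c ≢ d
  colours≢ eq eq′ y≢z refl = y≢z (trans (≡-sym eq) eq′)

  sides≢ : ∀ {c d} → missing μ c p ≡ true → missing μ d p ≡ false → c ≢ d
  sides≢ c∈ d∉ refl = true≢false (trans (≡-sym c∈) d∉)

  present : ∀ {c y} → μ c p ≡ y → p ≢ y → missing μ c p ≡ false
  present eq p≢y = dec-false (_ ≟ _) λ fix → p≢y (trans (≡-sym fix) eq)

  colour-p : ∀ {u} → p ≢ q → q ≢ u → Adj G p u ≡ true → ∃ λ c → μ c p ≡ u
  colour-p p≢q q≢u e = colour e λ { (inj₁ (_ , u≡q)) → q≢u (≡-sym u≡q) ; (inj₂ (p≡q , _)) → p≢q p≡q }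

  colour-off : ∀ {x y} → p ≢ x → q ≢ x → Adj G x y ≡ true → ∃ λ c → μ c x ≡ y
  colour-off p≢x q≢x e = colour e λ { (inj₁ (x≡p , _)) → p≢x (≡-sym x≡p) ; (inj₂ (x≡q , _)) → q≢x (≡-sym x≡q) }

  without-pq : ColourableWithout Δ G p q
  without-pq = μ , involutive , covers

  -- The colour of `pu` is present at `p`, hence missing at `q`, and can be moved from `pu` to `pq`.
  without-end : ∀ {u} → Unique (p ∷ q ∷ u ∷ []) → Adj G p u ≡ true → ColourableWithout Δ G p u
  without-end unique@((p≢q ∷ p≢u ∷ []) ∷ (q≢u ∷ []) ∷ _) pu
    with α , eα ← colour-p p≢q q≢u pu
    = playSplit unique {α ∷ []} ([] ∷ []) (present eα p≢u ∷ []) ((0F , 2F , 0F) ∷ []) (eα ∷ []) [] (0F , 2F) refl (fill (0F ∷ [])) refl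

  -- Let `α` and `β` be the colours of `pu` and `uw`. If `β` is missing at `p`, each colour moves
  -- one edge towards `q`. Otherwise, with `pu` and `uw` uncoloured, the chain of `γ` and `β` from
  -- `p` is exchanged to free `β` at `p`; if it ends at `u`, then `pq` takes `β` and `pu` gets `α`
  -- back.
  without-near : ∀ {u w γ} → Unique (p ∷ q ∷ u ∷ w ∷ []) → Adj G p u ≡ true → Adj G u w ≡ true →
    missing μ γ p ≡ true → ColourableWithout Δ G u w
  without-near {u} {w} {γ} unique@((p≢q ∷ p≢u ∷ p≢w ∷ []) ∷ (q≢u ∷ q≢w ∷ []) ∷ _) pu uw γ∈
    with α , eα ← colour-p p≢q q≢u pu
    with β , eβ ← colour-off p≢u q≢u uw
    with missing μ β p in β∈
  ... | true  = playSplit unique {α ∷ β ∷ []} ((α≢β ∷ []) ∷ [] ∷ []) (present eα p≢u ∷ β∈ ∷ [])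
      ((0F , 2F , 0F) ∷ (2F , 3F , 1F) ∷ []) (eα ∷ eβ ∷ []) ((0F , 2F) ∷ []) (2F , 3F) refl nearStrategy₁ refl
    where
    α≢β = colours≢ (reverse eα) eβ p≢w
  ... | false = playSplit unique {α ∷ γ ∷ β ∷ []} ((≢-sym (sides≢ γ∈ (present eα p≢u)) ∷ α≢β ∷ []) ∷ (sides≢ γ∈ β∈ ∷ []) ∷ [] ∷ [])
      (present eα p≢u ∷ γ∈ ∷ β∈ ∷ [])
      ((0F , 2F , 0F) ∷ (2F , 3F , 2F) ∷ []) (eα ∷ eβ ∷ []) ((0F , 2F) ∷ []) (2F , 3F) refl nearStrategy₂ refl
    where
    α≢β = colours≢ (reverse eα) eβ p≢w

  other-missing : ∀ {γ γ′} → γ ≢ γ′ → missing μ γ p ≡ true → missing μ γ′ p ≡ true → ∀ δ → ∃ λ ε → missing μ ε p ≡ true × δ ≢ ε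
  other-missing {γ} {γ′} γ≢γ′ γ∈ γ′∈ δ with δ ≟ γ
  ... | yes refl = γ′ , γ′∈ , γ≢γ′
  ... | no δ≢γ   = γ , γ∈ , δ≢γ

  -- The colours of `pu`, `uz`, `zw` are `α`, `δ`, `τ`. If `δ` is missing at `p` and `α` equals `τ`,
  -- every colour moves one edge towards `q`. The other cases begin with Kempe changes; two colours
  -- missing at `p` supply one different from `δ` or `τ` where the strategy needs it.
  without-path : ∀ {u z w γ γ′} → Unique (p ∷ q ∷ u ∷ z ∷ w ∷ []) → Adj G p u ≡ true → Adj G u z ≡ true → Adj G z w ≡ true →
    γ ≢ γ′ → missing μ γ p ≡ true → missing μ γ′ p ≡ true → ColourableWithout Δ G z w
  without-path {u} {z} {w} {γ} {γ′} unique@((p≢q ∷ p≢u ∷ p≢z ∷ p≢w ∷ []) ∷ (q≢u ∷ q≢z ∷ q≢w ∷ []) ∷ (u≢z ∷ u≢w ∷ []) ∷ _) pu uz zw γ≢γ′ γ∈ γ′∈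
    with α , eα ← colour-p p≢q q≢u pu
    with δ , eδ ← colour-off p≢u q≢u uz
    with τ , eτ ← colour-off p≢z q≢z zw
    = by-cases _ _ refl refl
    where
    α∉ = present eα p≢u
    α≢δ : α ≢ δ
    α≢δ = colours≢ (reverse eα) eδ p≢z
    δ≢τ : δ ≢ τ
    δ≢τ = colours≢ (reverse eδ) eτ u≢w
    out : ∀ {c d} → missing μ c p ≡ true → missing μ d p ≡ false → d ≢ c
    out c∈ d∉ = ≢-sym (sides≢ c∈ d∉)
    edges : ∀ {k} → (a d t : Fin k) → List (Fin 5 × Fin 5 × Fin k)
    edges a d t = (0F , 2F , a) ∷ (2F , 3F , d) ∷ (3F , 4F , t) ∷ []
    L : List (Fin 5 × Fin 5)
    L = (0F , 2F) ∷ (2F , 3F) ∷ []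
    -- The two booleans tell whether `δ` and `τ` are missing at `p`. A missing `τ` differs from `α`,
    -- which is present there, so the coincidence of `α` and `τ` is tested only when `τ` is present.
    by-cases : ∀ b b′ → missing μ δ p ≡ b → missing μ τ p ≡ b′ → ColourableWithout Δ G z w
    by-cases true true δ∈ τ∈ = playSplit unique {α ∷ δ ∷ τ ∷ []}
      ((α≢δ ∷ out τ∈ α∉ ∷ []) ∷ (δ≢τ ∷ []) ∷ [] ∷ []) (α∉ ∷ δ∈ ∷ τ∈ ∷ [])
      (edges 0F 1F 2F) (eα ∷ eδ ∷ eτ ∷ []) L (3F , 4F) refl pathStrategy₂ refl
    by-cases true false δ∈ τ∉ with α ≟ τ | other-missing γ≢γ′ γ∈ γ′∈ δ
    ... | yes refl | _ = playSplit unique {α ∷ δ ∷ []} ((α≢δ ∷ []) ∷ [] ∷ []) (α∉ ∷ δ∈ ∷ [])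
      (edges 0F 1F 0F) (eα ∷ eδ ∷ eτ ∷ []) L (3F , 4F) refl pathStrategy₁ refl
    ... | no α≢τ | ε , ε∈ , δ≢ε = playSplit unique {α ∷ δ ∷ ε ∷ τ ∷ []}
      ((α≢δ ∷ out ε∈ α∉ ∷ α≢τ ∷ []) ∷ (δ≢ε ∷ δ≢τ ∷ []) ∷ (sides≢ ε∈ τ∉ ∷ []) ∷ [] ∷ []) (α∉ ∷ δ∈ ∷ ε∈ ∷ τ∉ ∷ [])
      (edges 0F 1F 3F) (eα ∷ eδ ∷ eτ ∷ []) L (3F , 4F) refl pathStrategy₃ refl
    by-cases false true δ∉ τ∈ with ε , ε∈ , τ≢ε ← other-missing γ≢γ′ γ∈ γ′∈ τ = playSplit unique {α ∷ τ ∷ ε ∷ δ ∷ []}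
      ((out τ∈ α∉ ∷ out ε∈ α∉ ∷ α≢δ ∷ []) ∷ (τ≢ε ∷ ≢-sym δ≢τ ∷ []) ∷ (sides≢ ε∈ δ∉ ∷ []) ∷ [] ∷ []) (α∉ ∷ τ∈ ∷ ε∈ ∷ δ∉ ∷ [])
      (edges 0F 3F 1F) (eα ∷ eδ ∷ eτ ∷ []) L (3F , 4F) refl pathStrategy₄ refl
    by-cases false false δ∉ τ∉ with α ≟ τ
    ... | yes refl = playSplit unique {α ∷ γ ∷ γ′ ∷ δ ∷ []}
      ((out γ∈ α∉ ∷ out γ′∈ α∉ ∷ α≢δ ∷ []) ∷ (γ≢γ′ ∷ sides≢ γ∈ δ∉ ∷ []) ∷ (sides≢ γ′∈ δ∉ ∷ []) ∷ [] ∷ []) (α∉ ∷ γ∈ ∷ γ′∈ ∷ δ∉ ∷ [])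
      (edges 0F 3F 0F) (eα ∷ eδ ∷ eτ ∷ []) L (3F , 4F) refl pathStrategy₅ refl
    ... | no α≢τ = playSplit unique {α ∷ γ ∷ γ′ ∷ δ ∷ τ ∷ []}
      ((out γ∈ α∉ ∷ out γ′∈ α∉ ∷ α≢δ ∷ α≢τ ∷ []) ∷ (γ≢γ′ ∷ sides≢ γ∈ δ∉ ∷ sides≢ γ∈ τ∉ ∷ []) ∷ (sides≢ γ′∈ δ∉ ∷ sides≢ γ′∈ τ∉ ∷ []) ∷ (δ≢τ ∷ []) ∷ [] ∷ [])
      (α∉ ∷ γ∈ ∷ γ′∈ ∷ δ∉ ∷ τ∉ ∷ [])
      (edges 0F 3F 4F) (eα ∷ eδ ∷ eτ ∷ []) L (3F , 4F) refl pathStrategy₆ refl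

  -- The 4-cycle `p q u x` carries the tail `x z w`; `b`, `c`, `d`, `t` are the colours of `px`,
  -- `ux`, `xz`, `zw`. Since `p` misses only `a`, it is known for every colour which of `p` and `q`
  -- misses it. The coincidences left open by properness are `a = d`, `a = t`, `b = t` and `c = t`,
  -- and each consistent pattern has its own strategy.
  without-kite : ∀ {u x z w a} → Unique (p ∷ q ∷ u ∷ x ∷ z ∷ w ∷ []) → Adj G p x ≡ true → Adj G u x ≡ true →
    Adj G x z ≡ true → Adj G z w ≡ true → μ a q ≡ u → (∀ c → missing μ c p ≡ true → c ≡ a) → ColourableWithout Δ G z w
  without-kite {u} {x} {z} {w} {a}
    unique@((p≢q ∷ p≢u ∷ p≢x ∷ p≢z ∷ p≢w ∷ []) ∷ (q≢u ∷ q≢x ∷ q≢z ∷ q≢w ∷ []) ∷ (u≢x ∷ u≢z ∷ u≢w ∷ []) ∷ (x≢z ∷ x≢w ∷ []) ∷ _) px ux xz zw ea only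
    with b , eb ← colour-p p≢q q≢x px
    with c , ec ← colour-off p≢u q≢u ux
    with d , ed ← colour-off p≢x q≢x xz
    with t , et ← colour-off p≢z q≢z zw
    = by-cases
    where
    -- The edge `qu` makes `a` present at `q`, and each colour is missing at exactly one of `p` and
    -- `q`.
    a∈ : missing μ a p ≡ true
    a∈ with missing μ a p | exclusive a
    ... | true  | _  = refl
    ... | false | eq = contradiction (trans (≡-sym ea) (does⇒ (μ a q ≟ q) eq)) (≢-sym q≢u)
    in-B : ∀ {c} → a ≢ c → missing μ c p ≡ false
    in-B {c} a≢c with missing μ c p in eq
    ... | false = refl
    ... | true  = contradiction (≡-sym (only c eq)) a≢c
    a≢b : a ≢ b
    a≢b = sides≢ a∈ (present eb p≢x)
    a≢c : a ≢ c
    a≢c = colours≢ (reverse ea) ec q≢x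
    b≢c : b ≢ c
    b≢c = colours≢ (reverse eb) (reverse ec) p≢u
    b≢d : b ≢ d
    b≢d = colours≢ (reverse eb) ed p≢z
    c≢d : c ≢ d
    c≢d = colours≢ (reverse ec) ed u≢z
    d≢t : d ≢ t
    d≢t = colours≢ (reverse ed) et x≢w
    edges : ∀ {k} → (a b c d t : Fin k) → List (Fin 6 × Fin 6 × Fin k)
    edges a b c d t = (1F , 2F , a) ∷ (0F , 3F , b) ∷ (2F , 3F , c) ∷ (3F , 4F , d) ∷ (4F , 5F , t) ∷ []
    L : List (Fin 6 × Fin 6)
    L = (1F , 2F) ∷ (0F , 3F) ∷ (2F , 3F) ∷ (3F , 4F) ∷ []
    by-cases : ColourableWithout Δ G z w
    by-cases with a ≟ d | b ≟ t | c ≟ t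
    ... | yes refl | yes refl | _ = playSplit unique {a ∷ b ∷ c ∷ []} ((a≢b ∷ a≢c ∷ []) ∷ (b≢c ∷ []) ∷ [] ∷ []) (a∈ ∷ in-B a≢b ∷ in-B a≢c ∷ [])
      (edges 0F 1F 2F 0F 1F) (ea ∷ eb ∷ ec ∷ ed ∷ et ∷ []) L (4F , 5F) refl kiteStrategy₁ refl
    ... | yes refl | no _ | yes refl = playSplit unique {a ∷ b ∷ c ∷ []} ((a≢b ∷ a≢c ∷ []) ∷ (b≢c ∷ []) ∷ [] ∷ []) (a∈ ∷ in-B a≢b ∷ in-B a≢c ∷ [])
      (edges 0F 1F 2F 0F 2F) (ea ∷ eb ∷ ec ∷ ed ∷ et ∷ []) L (4F , 5F) refl kiteStrategy₂ refl
    ... | yes refl | no b≢t | no c≢t = playSplit unique {a ∷ b ∷ c ∷ t ∷ []}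
      ((a≢b ∷ a≢c ∷ d≢t ∷ []) ∷ (b≢c ∷ b≢t ∷ []) ∷ (c≢t ∷ []) ∷ [] ∷ []) (a∈ ∷ in-B a≢b ∷ in-B a≢c ∷ in-B d≢t ∷ [])
      (edges 0F 1F 2F 0F 3F) (ea ∷ eb ∷ ec ∷ ed ∷ et ∷ []) L (4F , 5F) refl kiteStrategy₃ refl
    ... | no a≢d | yes refl | _ = playSplit unique {a ∷ b ∷ c ∷ d ∷ []}
      ((a≢b ∷ a≢c ∷ a≢d ∷ []) ∷ (b≢c ∷ b≢d ∷ []) ∷ (c≢d ∷ []) ∷ [] ∷ []) (a∈ ∷ in-B a≢b ∷ in-B a≢c ∷ in-B a≢d ∷ [])
      (edges 0F 1F 2F 3F 1F) (ea ∷ eb ∷ ec ∷ ed ∷ et ∷ []) L (4F , 5F) refl kiteStrategy₅ refl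
    ... | no a≢d | no _ | yes refl = playSplit unique {a ∷ b ∷ c ∷ d ∷ []}
      ((a≢b ∷ a≢c ∷ a≢d ∷ []) ∷ (b≢c ∷ b≢d ∷ []) ∷ (c≢d ∷ []) ∷ [] ∷ []) (a∈ ∷ in-B a≢b ∷ in-B a≢c ∷ in-B a≢d ∷ [])
      (edges 0F 1F 2F 3F 2F) (ea ∷ eb ∷ ec ∷ ed ∷ et ∷ []) L (4F , 5F) refl kiteStrategy₆ refl
    ... | no a≢d | no b≢t | no c≢t with a ≟ t
    ...   | yes refl = playSplit unique {a ∷ b ∷ c ∷ d ∷ []}
      ((a≢b ∷ a≢c ∷ a≢d ∷ []) ∷ (b≢c ∷ b≢d ∷ []) ∷ (c≢d ∷ []) ∷ [] ∷ []) (a∈ ∷ in-B a≢b ∷ in-B a≢c ∷ in-B a≢d ∷ [])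
      (edges 0F 1F 2F 3F 0F) (ea ∷ eb ∷ ec ∷ ed ∷ et ∷ []) L (4F , 5F) refl kiteStrategy₄ refl
    ...   | no a≢t = playSplit unique {a ∷ b ∷ c ∷ d ∷ t ∷ []}
      ((a≢b ∷ a≢c ∷ a≢d ∷ a≢t ∷ []) ∷ (b≢c ∷ b≢d ∷ b≢t ∷ []) ∷ (c≢d ∷ c≢t ∷ []) ∷ (d≢t ∷ []) ∷ [] ∷ [])
      (a∈ ∷ in-B a≢b ∷ in-B a≢c ∷ in-B a≢d ∷ in-B a≢t ∷ [])
      (edges 0F 1F 2F 3F 4F) (ea ∷ eb ∷ ec ∷ ed ∷ et ∷ []) L (4F , 5F) refl kiteStrategy₇ refl

-- Edge colourings and families of matchings

colouredNeighbour-unique : ∀ {G : Graph n} (φ : EdgeColoring G k) → ∀ {x y z} →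
  Adj G x y ≡ true → Adj G x z ≡ true → EdgeColoring.col φ x y ≡ EdgeColoring.col φ x z → y ≡ z
colouredNeighbour-unique φ {x} {y} {z} xy xz eq with y ≟ z
... | yes y≡z = y≡z
... | no y≢z  = contradiction eq (EdgeColoring.proper φ x y z xy xz y≢z)

record PerfectMatching (G : Graph n) : Set where
  field
    partner    : Fin n → Fin n
    adjacent   : ∀ x → Adj G x (partner x) ≡ true
    involution : Involution partner

  partner≢ : ∀ x → partner x ≢ x
  partner≢ x = ≢-sym (adjacent⇒≢ G (adjacent x))

colourClass : ∀ {G : Graph n} (φ : EdgeColoring G k) (c : Fin k) →
  (∀ x → ∃ λ y → Adj G x y ≡ true × EdgeColoring.col φ x y ≡ c) → PerfectMatching G
colourClass {G = G} φ c present = record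
  { partner = λ x → proj₁ (present x)
  ; adjacent = λ x → proj₁ (proj₂ (present x))
  ; involution = λ x → let y , xy , eq = present x ; z , yz , eq′ = present y in
      colouredNeighbour-unique φ yz (trans (sym G y x) xy) (trans eq′ (trans (≡-sym eq) (colSym x y xy))) }
  where open EdgeColoring φ

-- Used to choose a colour for every pair of vertices, adjacent or not. Where `f` holds nowhere the
-- value defaults to the last index, so the index type has to be nonempty.
first : (Fin (suc k) → Bool) → Fin (suc k)
first {zero}  f = zero
first {suc k} f = if f zero then zero else suc (first (f ∘ suc))

first-cong : ∀ {f g : Fin (suc k) → Bool} → (∀ c → f c ≡ g c) → first f ≡ first g
first-cong {zero}          f≗g = refl
first-cong {suc k} {f} {g} f≗g rewrite f≗g zero with g zero
... | true  = refl
... | false = cong suc (first-cong (f≗g ∘ suc))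

first-true : ∀ {f : Fin (suc k) → Bool} c → f c ≡ true → f (first f) ≡ true
first-true {zero}      zero    fc = fc
first-true {suc k} {f} c       fc with f zero in f0
... | true  = f0
first-true {suc k} {f} zero    fc | false = contradiction (trans (≡-sym fc) f0) true≢false
first-true {suc k} {f} (suc c) fc | false = first-true c fc

-- An edge is given the first matching that joins its ends. Symmetry holds because the matchings are
-- involutions, and two edges at one vertex with the same colour would lead to the same neighbour.
matchings⇒colouring : ∀ {H : Graph n} {μ : Matchings (suc k) N} (f : Fin n → Fin N) → (∀ a b → f a ≡ f b → a ≡ b) → Involutive μ →
  (∀ a b → Adj H a b ≡ true → ∃ λ c → μ c (f a) ≡ f b) → EdgeColoring H (suc k)
matchings⇒colouring {H = H} {μ} f f-inj inv covers = record { col = col ; colSym = λ a b _ → first-cong (λ c → symmetric a b c) ; proper = proper }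
  where
  col : _ → _ → _
  col a b = first (λ c → does (μ c (f a) ≟ f b))
  symmetric : ∀ a b c → does (μ c (f a) ≟ f b) ≡ does (μ c (f b) ≟ f a)
  symmetric a b c = does-⇔ (mk⇔ back back) (μ c (f a) ≟ f b) (μ c (f b) ≟ f a)
    where
    back : ∀ {x y} → μ c x ≡ y → μ c y ≡ x
    back refl = inv c _
  joins : ∀ a b → Adj H a b ≡ true → μ (col a b) (f a) ≡ f b
  joins a b ab with c , eq ← covers a b ab = does⇒ (_ ≟ _) (first-true {f = λ c → does (μ c (f a) ≟ f b)} c (dec-true (_ ≟ _) eq))
  proper : ∀ a b c → Adj H a b ≡ true → Adj H a c ≡ true → b ≢ c → col a b ≢ col a c
  proper a b c ab ac b≢c eq = b≢c (f-inj b c (trans (≡-sym (joins a b ab)) (trans (cong (λ d → μ d (f a)) eq) (joins a c ac))))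

colourable-sym : ∀ {G : Graph N} {p q} → ColourableWithout Δ G p q → ColourableWithout Δ G q p
colourable-sym (μ , inv , covers) = μ , inv , λ x y e → [ inj₁ ∘ [ inj₂ , inj₁ ]′ , inj₂ ]′ (covers x y e)

-- Extend the matching of G by a fixed point zero; the chain it forms with the matching of H
-- starting at zero has no other end.
perfectMatching-parity : {G : Graph m} {H : Graph (suc m)} → PerfectMatching G → ¬ PerfectMatching H
perfectMatching-parity {m} P Q with otherEnd {τ = τ} Q.involution τ-involution {zero} (inj₂ (Q.partner≢ zero , refl))
  where
  module P = PerfectMatching P
  module Q = PerfectMatching Q
  τ : Fin (suc m) → Fin (suc m)
  τ zero    = zero
  τ (suc x) = suc (P.partner x)
  τ-involution : Involution τ
  τ-involution zero    = refl
  τ-involution (suc x) = cong suc (P.involution x)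
... | q     , _ , inj₁ (eq , _) , _ = PerfectMatching.partner≢ Q q eq
... | zero  , q≢ , inj₂ _ , _ = q≢ refl
... | suc x , _ , inj₂ (_ , eq) , _ = PerfectMatching.partner≢ P x (suc-injective eq)

-- Regular graphs

module _ (R : Graph m) (regular : Regular R Δ) where

  neighbours : ∀ x → Enumeration (Adj R x) Δ
  neighbours x = subst (Enumeration (Adj R x)) (regular x) (enumerate (Adj R x))

  -- The `Δ` neighbours of `x` take distinct values among `Δ` possible ones, so every value occurs.
  all-colours : ∀ {x} (h : Fin m → Fin Δ) → (∀ {y z} → Adj R x y ≡ true → Adj R x z ≡ true → h y ≡ h z → y ≡ z) →
    ∀ c → ∃ λ y → Adj R x y ≡ true × h y ≡ c
  all-colours {x} h h-inj c with injective⇒hits (h ∘ at) (λ {i} {j} eq → injective (h-inj (at-true i) (at-true j) eq)) c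
    where open Enumeration (neighbours x)
  ... | i , eq = _ , Enumeration.at-true (neighbours x) i , eq

module _ {R : Graph m} {Δ : ℕ} (regular : Regular R Δ) (dense : 2 * suc m ≤ 3 * Δ + 4) where

  private
    is : Fin m → Fin m → Bool
    is x y = does (y ≟ x)

    1≤is : ∀ x → 1 ≤ count (is x)
    1≤is x = count-positive x (dec-true (x ≟ x) refl)

  -- Otherwise the two neighbourhoods and the vertices `x` and `y` are disjoint, so `2Δ + 2 ≤ m`,
  -- and then `4Δ + 6 ≤ 2m + 2 ≤ 3Δ + 4`.
  commonNeighbour₂ : ∀ {x y} → x ≢ y → Adj R x y ≡ false → ∃ λ u → Adj R x u ≡ true × Adj R y u ≡ true
  commonNeighbour₂ {x} {y} x≢y xy with any? (λ u → (Adj R x u ≟ᵇ true) ×-dec (Adj R y u ≟ᵇ true))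
  ... | yes found = found
  ... | no none   = contradiction too-many 1+n≰n
    where
    pointwise : ∀ i → sum (map (λ f → bit (f i)) (Adj R x ∷ Adj R y ∷ is x ∷ is y ∷ [])) ≤ 1
    pointwise i with i ≟ x | i ≟ y
    ... | yes refl | yes refl = contradiction refl x≢y
    ... | yes refl | no _ rewrite irref R x | sym R y x | xy = ≤-refl
    ... | no _ | yes refl rewrite irref R y | xy = ≤-refl
    ... | no _ | no _ with Adj R x i in xi | Adj R y i in yi
    ...   | true  | true  = contradiction (i , xi , yi) none
    ...   | true  | false = ≤-refl
    ...   | false | true  = ≤-refl
    ...   | false | false = z≤n
    bound : Δ + (Δ + (1 + (1 + 0))) ≤ m * 1
    bound = ≤-trans (+-mono-≤ (≤-reflexive (≡-sym (regular x))) (+-mono-≤ (≤-reflexive (≡-sym (regular y))) 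
      (+-mono-≤ (1≤is x) (+-mono-≤ (1≤is y) ≤-refl)))) (sum-count (Adj R x ∷ Adj R y ∷ is x ∷ is y ∷ []) pointwise)
    open ≤-Reasoning
    too-many : suc (Δ + 3 * Δ + 5) ≤ Δ + 3 * Δ + 5
    too-many = begin
      suc (Δ + 3 * Δ + 5)             ≡⟨ lhs Δ ⟩
      2 * suc (Δ + (Δ + (1 + (1 + 0)))) ≤⟨ *-monoʳ-≤ 2 (s≤s (≤-trans bound (≤-reflexive (*-identityʳ m)))) ⟩
      2 * suc m                       ≤⟨ dense ⟩
      3 * Δ + 4                       ≤⟨ +-mono-≤ (m≤n+m (3 * Δ) Δ) (m≤n+m 4 1) ⟩
      Δ + 3 * Δ + 5                   ∎
      where
      lhs : ∀ Δ → suc (Δ + 3 * Δ + 5) ≡ 2 * suc (Δ + (Δ + (1 + (1 + 0))))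
      lhs = solve-∀

  -- Otherwise `3Δ + 3` incidences fall on `m` vertices with at most two on each, and
  -- `3Δ + 5 ≤ 2m + 2` violates the degree condition by exactly one.
  commonNeighbour₃ : ∀ {x y z} → Adj R x y ≡ true → Adj R x z ≡ false → Adj R y z ≡ false → x ≢ z →
    ∃ λ u → Adj R x u ≡ true × Adj R y u ≡ true × Adj R z u ≡ true
  commonNeighbour₃ {x} {y} {z} xy xz yz x≢z with any? (λ u → (Adj R x u ≟ᵇ true) ×-dec (Adj R y u ≟ᵇ true) ×-dec (Adj R z u ≟ᵇ true))
  ... | yes found = found
  ... | no none   = contradiction too-many 1+n≰n
    where
    -- `z` lies in none of the three neighbourhoods and can be added twice; `x` lies only in that of
    -- `y` and can be added once.
    fs = Adj R x ∷ Adj R y ∷ Adj R z ∷ is x ∷ is z ∷ is z ∷ []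
    pointwise : ∀ i → sum (map (λ f → bit (f i)) fs) ≤ 2
    pointwise i with i ≟ x | i ≟ z
    ... | yes refl | yes refl = contradiction refl x≢z
    ... | yes refl | no _ rewrite irref R x | sym R y x | xy | sym R z x | xz = ≤-refl
    ... | no _ | yes refl rewrite irref R z | xz | yz = ≤-refl
    ... | no _ | no _ with Adj R x i in xi | Adj R y i in yi | Adj R z i in zi
    ...   | true  | true  | true  = contradiction (i , xi , yi , zi) none
    ...   | true  | true  | false = ≤-refl
    ...   | true  | false | true  = ≤-refl
    ...   | true  | false | false = s≤s z≤n
    ...   | false | true  | true  = ≤-refl
    ...   | false | true  | false = s≤s z≤n
    ...   | false | false | true  = s≤s z≤n
    ...   | false | false | false = z≤n
    bound : Δ + (Δ + (Δ + (1 + (1 + (1 + 0))))) ≤ m * 2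
    bound = ≤-trans (+-mono-≤ (≤-reflexive (≡-sym (regular x))) (+-mono-≤ (≤-reflexive (≡-sym (regular y))) (+-mono-≤ (≤-reflexive (≡-sym (regular z)))
      (+-mono-≤ (1≤is x) (+-mono-≤ (1≤is z) (+-mono-≤ (1≤is z) ≤-refl)))))) (sum-count fs pointwise)
    open ≤-Reasoning
    too-many : suc (3 * Δ + 4) ≤ 3 * Δ + 4
    too-many = begin
      suc (3 * Δ + 4)                           ≡⟨ lhs Δ ⟩
      2 + (Δ + (Δ + (Δ + (1 + (1 + (1 + 0)))))) ≤⟨ s≤s (s≤s bound) ⟩
      2 + m * 2                                 ≡⟨ rhs m ⟩
      2 * suc m                                 ≤⟨ dense ⟩
      3 * Δ + 4                                 ∎
      where
      lhs : ∀ Δ → suc (3 * Δ + 4) ≡ 2 + (Δ + (Δ + (Δ + (1 + (1 + (1 + 0))))))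
      lhs = solve-∀
      rhs : ∀ m → 2 + m * 2 ≡ 2 * suc m
      rhs = solve-∀

  -- The neighbours of `x` together with `x`, `y`, `z` are `Δ + 3` distinct vertices, so
  -- `2Δ + 8 ≤ 2m + 2 ≤ 3Δ + 4`. This later supplies two colours different from a given one.
  large-degree : ∀ {x y z} → x ≢ y → x ≢ z → y ≢ z → Adj R x y ≡ false → Adj R x z ≡ false → 4 ≤ Δ
  large-degree {x} {y} {z} x≢y x≢z y≢z xy xz = +-cancelˡ-≤ (2 * Δ + 4) 4 Δ (begin
      2 * Δ + 4 + 4                         ≡⟨ lhs Δ ⟩
      2 * suc (Δ + (1 + (1 + (1 + 0))))      ≤⟨ *-monoʳ-≤ 2 (s≤s (≤-trans bound (≤-reflexive (*-identityʳ m)))) ⟩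
      2 * suc m                             ≤⟨ dense ⟩
      3 * Δ + 4                             ≡⟨ rhs Δ ⟩
      2 * Δ + 4 + Δ                         ∎)
    where
    open ≤-Reasoning
    fs = Adj R x ∷ is x ∷ is y ∷ is z ∷ []
    pointwise : ∀ i → sum (map (λ f → bit (f i)) fs) ≤ 1
    pointwise i with i ≟ x | i ≟ y | i ≟ z
    ... | yes refl | yes refl | _        = contradiction refl x≢y
    ... | yes refl | no _     | yes refl = contradiction refl x≢z
    ... | yes refl | no _     | no _     rewrite irref R x = ≤-refl
    ... | no _     | yes refl | yes refl = contradiction refl y≢z
    ... | no _     | yes refl | no _     rewrite xy = ≤-refl
    ... | no _     | no _     | yes refl rewrite xz = ≤-refl
    ... | no _     | no _     | no _     with Adj R x i
    ...   | true  = ≤-refl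
    ...   | false = z≤n
    bound : Δ + (1 + (1 + (1 + 0))) ≤ m * 1
    bound = ≤-trans (+-mono-≤ (≤-reflexive (≡-sym (regular x))) (+-mono-≤ (1≤is x) (+-mono-≤ (1≤is y) (+-mono-≤ (1≤is z) ≤-refl)))) (sum-count fs pointwise)
    lhs : ∀ Δ → 2 * Δ + 4 + 4 ≡ 2 * suc (Δ + (1 + (1 + (1 + 0))))
    lhs = solve-∀
    rhs : ∀ Δ → 3 * Δ + 4 ≡ 2 * Δ + 4 + Δ
    rhs = solve-∀

-- Vertex splitting

∧-intro : ∀ {a b} → a ≡ true → b ≡ true → a ∧ b ≡ true
∧-intro refl refl = refl

module _ (R : Graph m) (v : Fin m) (A : Fin m → Bool) where
  open Split R v A

  private
    G : Graph (suc m)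
    G = splitGraph R v A

  toV2-v : toV2 v ≡ true
  toV2-v with v ≟ v
  ... | yes _  = refl
  ... | no v≢v = contradiction refl v≢v

  toV2-off : ∀ {y} → y ≢ v → toV2 y ≡ Adj R y v ∧ not (A y)
  toV2-off {y} y≢v with y ≟ v
  ... | yes y≡v = contradiction y≡v y≢v
  ... | no _    = refl

  old-v : ∀ {y} → y ≢ v → old v y ≡ Adj R y v ∧ A y
  old-v {y} y≢v with v ≟ v | y ≟ v
  ... | no v≢v | _       = contradiction refl v≢v
  ... | yes _  | yes y≡v = contradiction y≡v y≢v
  ... | yes _  | no _    = refl

  old-off : ∀ {x y} → x ≢ v → y ≢ v → old x y ≡ Adj R x y
  old-off {x} {y} x≢v y≢v with x ≟ v | y ≟ v
  ... | yes x≡v | _       = contradiction x≡v x≢v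
  ... | no _    | yes y≡v = contradiction y≡v y≢v
  ... | no _    | no _    = refl

  data Neighbour : Fin (suc m) → Fin (suc m) → Set where
    v₂v₁ : Neighbour zero (suc v)
    v₁v₂ : Neighbour (suc v) zero
    v₂-  : ∀ {y} → y ≢ v → Adj R y v ≡ true → A y ≡ false → Neighbour zero (suc y)
    -v₂  : ∀ {y} → y ≢ v → Adj R y v ≡ true → A y ≡ false → Neighbour (suc y) zero
    v₁-  : ∀ {y} → y ≢ v → Adj R y v ≡ true → A y ≡ true → Neighbour (suc v) (suc y)
    -v₁  : ∀ {y} → y ≢ v → Adj R y v ≡ true → A y ≡ true → Neighbour (suc y) (suc v)
    off  : ∀ {x y} → x ≢ v → y ≢ v → Adj R x y ≡ true → Neighbour (suc x) (suc y)

  neighbour : ∀ X Y → Adj G X Y ≡ true → Neighbour X Y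
  neighbour zero (suc y) e with y ≟ v
  ... | yes refl = v₂v₁
  ... | no y≢v with yv , Ay ← ∧-split {Adj R y v} e = v₂- y≢v yv (not-true Ay)
  neighbour (suc x) zero e with x ≟ v
  ... | yes refl = v₁v₂
  ... | no x≢v with xv , Ax ← ∧-split {Adj R x v} e = -v₂ x≢v xv (not-true Ax)
  neighbour (suc x) (suc y) e with x ≟ v | y ≟ v
  ... | yes refl | no y≢v with yv , Ay ← ∧-split {Adj R y v} e = v₁- y≢v yv Ay
  neighbour (suc x) (suc y) e | no x≢v | yes refl with xv , Ax ← ∧-split {Adj R x v} e = -v₁ x≢v xv Ax
  neighbour (suc x) (suc y) e | no x≢v | no y≢v = off x≢v y≢v e

  adjacent : ∀ {X Y} → Neighbour X Y → Adj G X Y ≡ true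
  adjacent v₂v₁ = toV2-v
  adjacent v₁v₂ = toV2-v
  adjacent (v₂- y≢v yv Ay)  = trans (toV2-off y≢v) (∧-intro yv (cong not Ay))
  adjacent (-v₂ y≢v yv Ay)  = trans (toV2-off y≢v) (∧-intro yv (cong not Ay))
  adjacent (v₁- y≢v yv Ay)  = trans (old-v y≢v) (∧-intro yv Ay)
  adjacent (-v₁ {y} y≢v yv Ay) = trans (oldSym y v) (trans (old-v y≢v) (∧-intro yv Ay))
  adjacent (off x≢v y≢v xy) = trans (old-off x≢v y≢v) xy

  -- The neighbour of `suc x` in the split graph that stands for the neighbour `y` of `x`: `v` is
  -- replaced by whichever of its two halves received `x`.
  lift : Fin m → Fin m → Fin (suc m)
  lift x y = if does (y ≟ v) then (if A x then suc v else zero) else suc y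

  lift-off : ∀ {x y} → y ≢ v → lift x y ≡ suc y
  lift-off {y = y} y≢v rewrite dec-false (y ≟ v) y≢v = refl

  lift-v₁ : ∀ {x} → A x ≡ true → lift x v ≡ suc v
  lift-v₁ Ax rewrite dec-true (v ≟ v) refl | Ax = refl

  lift-v₂ : ∀ {x} → A x ≡ false → lift x v ≡ zero
  lift-v₂ Ax rewrite dec-true (v ≟ v) refl | Ax = refl

  lift-adjacent : ∀ {x y} → x ≢ v → Adj R x y ≡ true → Adj G (suc x) (lift x y) ≡ true
  lift-adjacent {x} {y} x≢v xy with y ≟ v
  ... | no y≢v   = adjacent (off x≢v y≢v xy)
  ... | yes refl with A x in Ax
  ...   | true  = adjacent (-v₁ x≢v xy Ax)
  ...   | false = adjacent (-v₂ x≢v xy Ax)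

  collapse : Fin (suc m) → Fin m
  collapse zero    = v
  collapse (suc y) = y

  collapse-lift : ∀ x y → collapse (lift x y) ≡ y
  collapse-lift x y with y ≟ v
  ... | no _     = refl
  ... | yes refl with A x
  ...   | true  = refl
  ...   | false = refl

  lift-injective : ∀ {x y z} → lift x y ≡ lift x z → y ≡ z
  lift-injective {x} {y} {z} eq = trans (≡-sym (collapse-lift x y)) (trans (cong collapse eq) (collapse-lift x z))

  -- `collapse` and `lift x` identify the neighbours of `suc x` in `G` with those of `x` in `R`.
  degree-off : ∀ {x} → x ≢ v → degree G (suc x) ≡ degree R x
  degree-off {x} x≢v = ≤-antisym
    (count-injection collapse (λ Y e → collapse-adjacent (neighbour _ Y e)) (λ Y Z e e′ → collapse-injective (neighbour _ Y e) (neighbour _ Z e′)))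
    (count-injection {g = Adj G (suc x)} (lift x) (λ y → lift-adjacent x≢v) (λ y z _ _ → lift-injective))
    where
    collapse-adjacent : ∀ {Y} → Neighbour (suc x) Y → Adj R x (collapse Y) ≡ true
    collapse-adjacent v₁v₂         = contradiction refl x≢v
    collapse-adjacent (-v₂ _ xv _) = xv
    collapse-adjacent (v₁- _ _ _)  = contradiction refl x≢v
    collapse-adjacent (-v₁ _ xv _) = xv
    collapse-adjacent (off _ _ xy) = xy
    lifted : ∀ {Y} → Neighbour (suc x) Y → Y ≡ lift x (collapse Y)
    lifted v₁v₂            = contradiction refl x≢v
    lifted (-v₂ _ _ Ax)    = ≡-sym (lift-v₂ Ax)
    lifted (v₁- _ _ _)     = contradiction refl x≢v
    lifted (-v₁ _ _ Ax)    = ≡-sym (lift-v₁ Ax)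
    lifted (off _ y≢v _)   = ≡-sym (lift-off y≢v)
    collapse-injective : ∀ {Y Z} → Neighbour (suc x) Y → Neighbour (suc x) Z → collapse Y ≡ collapse Z → Y ≡ Z
    collapse-injective Y Z eq = trans (lifted Y) (trans (cong (lift x) eq) (≡-sym (lifted Z)))

  -- Compared with `v`, the vertex `v₁` has gained `v₂` and lost at least `u`, so sending `v₂` to
  -- `u` embeds its neighbourhood in that of `v`.
  degree-v₁ : ∀ {u} → Adj R u v ≡ true → A u ≡ false → degree G (suc v) ≤ degree R v
  degree-v₁ {u} uv Au = count-injection h (λ Y e → h-adjacent (neighbour _ Y e)) (λ Y Z e e′ → h-injective (neighbour _ Y e) (neighbour _ Z e′))
    where
    h : Fin (suc m) → Fin m
    h zero    = u
    h (suc y) = y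
    h-adjacent : ∀ {Y} → Neighbour (suc v) Y → Adj R v (h Y) ≡ true
    h-adjacent v₁v₂          = trans (sym R v u) uv
    h-adjacent (-v₂ v≢v _ _) = contradiction refl v≢v
    h-adjacent (v₁- _ yv _)  = trans (sym R v _) yv
    h-adjacent (-v₁ v≢v _ _) = contradiction refl v≢v
    h-adjacent (off v≢v _ _) = contradiction refl v≢v
    A-true : ∀ {y} → Neighbour (suc v) (suc y) → A y ≡ true
    A-true (v₁- _ _ Ay)   = Ay
    A-true (-v₁ v≢v _ _)  = contradiction refl v≢v
    A-true (off v≢v _ _)  = contradiction refl v≢v
    h-injective : ∀ {Y Z} → Neighbour (suc v) Y → Neighbour (suc v) Z → h Y ≡ h Z → Y ≡ Z
    h-injective {zero}  {zero}  Y Z eq   = refl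
    h-injective {zero}  {suc z} Y Z refl = contradiction (trans (≡-sym (A-true Z)) Au) true≢false
    h-injective {suc y} {zero}  Y Z refl = contradiction (trans (≡-sym (A-true Y)) Au) true≢false
    h-injective {suc y} {suc z} Y Z refl = refl

  degree-v₂ : ∀ {u} → Adj R u v ≡ true → A u ≡ true → degree G zero ≤ degree R v
  degree-v₂ {u} uv Au = count-injection h (λ Y e → h-adjacent (neighbour _ Y e)) (λ Y Z e e′ → h-injective (neighbour _ Y e) (neighbour _ Z e′))
    where
    h : Fin (suc m) → Fin m
    h Y = if does (collapse Y ≟ v) then u else collapse Y
    h-v : h (suc v) ≡ u
    h-v rewrite dec-true (v ≟ v) refl = refl
    h-off : ∀ {y} → y ≢ v → h (suc y) ≡ y
    h-off {y} y≢v rewrite dec-false (y ≟ v) y≢v = refl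
    h-adjacent : ∀ {Y} → Neighbour zero Y → Adj R v (h Y) ≡ true
    h-adjacent v₂v₁           = trans (cong (Adj R v) h-v) (trans (sym R v u) uv)
    h-adjacent (v₂- y≢v yv _) = trans (cong (Adj R v) (h-off y≢v)) (trans (sym R v _) yv)
    h-injective : ∀ {Y Z} → Neighbour zero Y → Neighbour zero Z → h Y ≡ h Z → Y ≡ Z
    h-injective v₂v₁ v₂v₁ eq = refl
    h-injective v₂v₁ (v₂- z≢v _ Az) eq with refl ← trans (≡-sym h-v) (trans eq (h-off z≢v)) = contradiction (trans (≡-sym Au) Az) true≢false
    h-injective (v₂- y≢v _ Ay) v₂v₁ eq with refl ← trans (≡-sym h-v) (trans (≡-sym eq) (h-off y≢v)) = contradiction (trans (≡-sym Au) Ay) true≢false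
    h-injective (v₂- y≢v _ _) (v₂- z≢v _ _) eq = cong suc (trans (≡-sym (h-off y≢v)) (trans eq (h-off z≢v)))

  isMaxDegree-unique : ValidSplit R v A → Regular R Δ → ∀ {d} → IsMaxDegree G d → d ≡ Δ
  isMaxDegree-unique _ _ (_ , inj₁ (() , _))
  isMaxDegree-unique {Δ} ((u , uv , Au) , (u′ , u′v , Au′)) regular {d} (bounded , inj₂ (X , eq)) = ≤-antisym
    (≤-trans (≤-reflexive (≡-sym eq)) (at-most X))
    (≤-trans (≤-reflexive (≡-sym (trans (degree-off (adjacent⇒≢ R uv)) (regular u)))) (bounded (suc u)))
    where
    at-most : ∀ X → degree G X ≤ Δ
    at-most zero = ≤-trans (degree-v₂ uv Au) (≤-reflexive (regular v))
    at-most (suc x) = by-cases (x ≟ v)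
      where
      by-cases : Dec (x ≡ v) → degree G (suc x) ≤ Δ
      by-cases (yes refl) = ≤-trans (degree-v₁ u′v Au′) (≤-reflexive (regular v))
      by-cases (no x≢v)   = ≤-reflexive (trans (degree-off x≢v) (regular x))

-- Class 1 regular graphs and their splittings

record Factorisation (Δ : ℕ) (R : Graph m) : Set where
  field
    ρ            : Matchings Δ m
    ρ-adjacent   : ∀ c x → Adj R x (ρ c x) ≡ true
    ρ-involution : Involutive ρ
    ρ-covers     : ∀ {x y} → Adj R x y ≡ true → ∃ λ c → ρ c x ≡ y

  ρ≢ : ∀ c x → ρ c x ≢ x
  ρ≢ c x = ≢-sym (adjacent⇒≢ R (ρ-adjacent c x))

  factor : Fin Δ → PerfectMatching R
  factor c = record { partner = ρ c ; adjacent = ρ-adjacent c ; involution = ρ-involution c }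

-- The `Δ` edges at a vertex have distinct colours out of `Δ`, so no colour is missing anywhere and
-- each class is a perfect matching.
factorise : {R : Graph m} → Regular R Δ → EdgeColoring R Δ → Factorisation Δ R
factorise {Δ = Δ} {R} regular φ = record
  { ρ = λ c → PerfectMatching.partner (class c)
  ; ρ-adjacent = λ c → PerfectMatching.adjacent (class c)
  ; ρ-involution = λ c → PerfectMatching.involution (class c)
  ; ρ-covers = λ {x} {y} xy → col x y , colouredNeighbour-unique φ (PerfectMatching.adjacent (class (col x y)) x) xy (proj₂ (proj₂ (sees (col x y) x))) }
  where
  open EdgeColoring φ
  sees : ∀ c x → ∃ λ y → Adj R x y ≡ true × col x y ≡ c
  sees c x = all-colours R regular (col x) (colouredNeighbour-unique φ) c
  class : Fin Δ → PerfectMatching R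
  class c = colourClass φ c (sees c)

module _ {R : Graph m} {Δ : ℕ} (F : Factorisation Δ R) where
  open Factorisation F

  module _ (v : Fin m) (A : Fin m → Bool) where

    private
      G : Graph (suc m)
      G = splitGraph R v A

    split-ρ : Matchings Δ (suc m)
    split-ρ c zero    = if A (ρ c v) then zero else suc (ρ c v)
    split-ρ c (suc x) = if does (x ≟ v) then (if A (ρ c v) then suc (ρ c v) else suc v) else lift R v A x (ρ c x)

    split-v₁ : ∀ c → split-ρ c (suc v) ≡ (if A (ρ c v) then suc (ρ c v) else suc v)
    split-v₁ c rewrite dec-true (v ≟ v) refl = refl

    split-v₁-moved : ∀ {c} → A (ρ c v) ≡ true → split-ρ c (suc v) ≡ suc (ρ c v)
    split-v₁-moved {c} Aρ = trans (split-v₁ c) (cong (if_then suc (ρ c v) else suc v) Aρ)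

    split-v₁-fixed : ∀ {c} → A (ρ c v) ≡ false → split-ρ c (suc v) ≡ suc v
    split-v₁-fixed {c} Aρ = trans (split-v₁ c) (cong (if_then suc (ρ c v) else suc v) Aρ)

    split-off : ∀ {c x} → x ≢ v → split-ρ c (suc x) ≡ lift R v A x (ρ c x)
    split-off {x = x} x≢v rewrite dec-false (x ≟ v) x≢v = refl

    split-far : ∀ {c x} → x ≢ v → ρ c x ≢ v → split-ρ c (suc x) ≡ suc (ρ c x)
    split-far {c} {x} x≢v ρ≢v = trans (split-off {c} x≢v) (lift-off R v A ρ≢v)

    split-near₁ : ∀ {c} → A (ρ c v) ≡ true → split-ρ c (suc (ρ c v)) ≡ suc v
    split-near₁ {c} Aρ = trans (split-off {c} (ρ≢ c v)) (trans (cong (lift R v A (ρ c v)) (ρ-involution c v)) (lift-v₁ R v A Aρ))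

    split-near₂ : ∀ {c} → A (ρ c v) ≡ false → split-ρ c (suc (ρ c v)) ≡ zero
    split-near₂ {c} Aρ = trans (split-off {c} (ρ≢ c v)) (trans (cong (lift R v A (ρ c v)) (ρ-involution c v)) (lift-v₂ R v A Aρ))

    split-involutive : Involutive split-ρ
    split-involutive c zero with A (ρ c v) in Aρ
    ... | true  rewrite Aρ = refl
    ... | false = split-near₂ Aρ
    split-involutive c (suc x) = by-cases (x ≟ v) (ρ c x ≟ v)
      where
      by-cases : Dec (x ≡ v) → Dec (ρ c x ≡ v) → split-ρ c (split-ρ c (suc x)) ≡ suc x
      by-cases (yes refl) _ = via _ refl
        where
        via : ∀ b → A (ρ c v) ≡ b → split-ρ c (split-ρ c (suc v)) ≡ suc v
        via true  Aρ = trans (cong (split-ρ c) (split-v₁-moved Aρ)) (split-near₁ Aρ)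
        via false Aρ = trans (cong (split-ρ c) (split-v₁-fixed Aρ)) (split-v₁-fixed Aρ)
      by-cases (no x≢v) (no ρx≢v) = trans (cong (split-ρ c) (split-far {c} x≢v ρx≢v)) (trans
        (split-far {c} ρx≢v (λ eq → x≢v (trans (≡-sym (ρ-involution c x)) eq))) (cong suc (ρ-involution c x)))
      by-cases (no x≢v) (yes ρx≡v) with refl ← trans (≡-sym (ρ-involution c x)) (cong (ρ c) ρx≡v) = via _ refl
        where
        via : ∀ b → A (ρ c v) ≡ b → split-ρ c (split-ρ c (suc (ρ c v))) ≡ suc (ρ c v)
        via true  Aρ = trans (cong (split-ρ c) (split-near₁ Aρ)) (split-v₁-moved Aρ)
        via false Aρ = trans (cong (split-ρ c) (split-near₂ Aρ)) (cong (if_then zero else suc (ρ c v)) Aρ)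

    splitColouring : SplitColouring Δ G (suc v) zero
    splitColouring = record
      { μ = split-ρ ; involutive = split-involutive ; exclusive = exclusive ; full = full
      ; covers = λ X Y e → covers (neighbour R v A X Y e) }
      where
      exclusive : ∀ c → missing split-ρ c zero ≡ not (missing split-ρ c (suc v))
      exclusive c rewrite split-v₁ c with A (ρ c v)
      ... | true  = ≡-sym (cong not (dec-false (_ ≟ _) (ρ≢ c v ∘ suc-injective)))
      ... | false = ≡-sym (cong not (dec-true (suc v ≟ suc v) refl))
      full : ∀ c X → split-ρ c X ≡ X → X ≡ suc v ⊎ X ≡ zero
      full c zero    _  = inj₂ refl
      full c (suc x) eq = by-cases (x ≟ v)
        where
        by-cases : Dec (x ≡ v) → suc x ≡ suc v ⊎ suc x ≡ zero
        by-cases (yes refl) = inj₁ refl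
        by-cases (no x≢v)   = contradiction
          (trans (≡-sym (collapse-lift R v A x (ρ c x))) (cong (collapse R v A) (trans (≡-sym (split-off {c} x≢v)) eq))) (ρ≢ c x)
      covers : ∀ {X Y} → Neighbour R v A X Y → SameEdge X Y (suc v) zero ⊎ ∃ λ c → split-ρ c X ≡ Y
      covers v₂v₁ = inj₁ (inj₂ (refl , refl))
      covers v₁v₂ = inj₁ (inj₁ (refl , refl))
      covers (v₂- {y} y≢v yv Ay) with c , refl ← ρ-covers (trans (sym R v y) yv) = inj₂ (c , cong (if_then zero else suc (ρ c v)) Ay)
      covers (-v₂ {y} y≢v yv Ay) with c , refl ← ρ-covers (trans (sym R v y) yv) = inj₂ (c , split-near₂ Ay)
      covers (v₁- {y} y≢v yv Ay) with c , refl ← ρ-covers (trans (sym R v y) yv) = inj₂ (c , split-v₁-moved Ay)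
      covers (-v₁ {y} y≢v yv Ay) with c , refl ← ρ-covers (trans (sym R v y) yv) = inj₂ (c , split-near₁ Ay)
      covers (off {x} {y} x≢v y≢v xy) with c , refl ← ρ-covers xy = inj₂ (c , split-far {c} x≢v y≢v)

two-others : 3 ≤ Δ → (γ : Fin Δ) → ∃₂ λ β β′ → β ≢ β′ × β ≢ γ × β′ ≢ γ
two-others (s≤s (s≤s (s≤s _))) γ = punchIn γ 0F , punchIn γ 1F , (λ eq → 0≢1+n (punchIn-injective γ 0F 1F eq)) , punchInᵢ≢i γ 0F , punchInᵢ≢i γ 1F

weaken-colours : ∀ {j} {H : Graph n} → j ≤ Δ → EdgeColoring H j → EdgeColoring H Δ
weaken-colours j≤Δ ψ = record
  { col = λ x y → inject≤ (col x y) j≤Δ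
  ; colSym = λ x y e → cong (λ c → inject≤ c j≤Δ) (colSym x y e)
  ; proper = λ x y z e e′ y≢z eq → proper x y z e e′ y≢z (inject≤-injective j≤Δ j≤Δ _ _ eq) }
  where open EdgeColoring ψ

-- Chromatic index of the split graph

module _ {R : Graph m} {Δ : ℕ} (F : Factorisation Δ R) (v : Fin m) (A : Fin m → Bool) where
  open Factorisation F

  private
    G : Graph (suc m)
    G = splitGraph R v A

  -- With no isolated vertices in `G`, a subgraph that omits a vertex also omits an edge. The given
  -- colour serves to name a neighbour of `x`.
  some-neighbour : Fin Δ → ∀ X → ∃ λ Y → Adj G X Y ≡ true
  some-neighbour c zero    = suc v , adjacent R v A v₂v₁
  some-neighbour c (suc x) = by-cases (x ≟ v)
    where
    by-cases : Dec (x ≡ v) → ∃ λ Y → Adj G (suc x) Y ≡ true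
    by-cases (yes refl) = zero , adjacent R v A v₁v₂
    by-cases (no x≢v)   = lift R v A x (ρ c x) , lift-adjacent R v A x≢v (ρ-adjacent c x)

  colouring-Δ+1 : EdgeColoring G (suc Δ)
  colouring-Δ+1 = matchings⇒colouring {μ = μ⁺} id (λ _ _ → id) inv⁺ covers⁺
    where
    open SplitColouring (splitColouring F v A)
    μ⁺ : Matchings (suc Δ) (suc m)
    -- The additional colour `zero` is used on the edge between `v₁` and `v₂` alone.
    μ⁺ zero    = link (suc v) zero id
    μ⁺ (suc c) = μ c
    inv⁺ : Involutive μ⁺
    inv⁺ zero    = link-involution {p = suc v} {zero} {id} (λ _ → refl) refl refl
    inv⁺ (suc c) = involutive c
    covers⁺ : ∀ X Y → Adj G X Y ≡ true → ∃ λ c → μ⁺ c X ≡ Y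
    covers⁺ X Y e with covers X Y e
    ... | inj₁ (inj₁ (refl , refl)) = zero , link-left {p = suc v} {zero} {id}
    ... | inj₁ (inj₂ (refl , refl)) = zero , link-right {p = suc v} {zero} {id}
    ... | inj₂ (c , eq)             = suc c , eq

module _ {R : Graph m} {Δ : ℕ} (regular : Regular R Δ) (F : Factorisation Δ R) (v : Fin m) (A : Fin m → Bool) where
  open Factorisation F

  private
    G : Graph (suc m)
    G = splitGraph R v A

    near⇒≢ : ∀ {x} → Adj R x v ≡ true → x ≢ v
    near⇒≢ = adjacent⇒≢ R

  -- Were G Δ-colourable, two of the Δ edges at v₁ and v₂ other than v₁v₂ would share a colour,
  -- and that colour would be a perfect matching of G.
  not-colourable : ¬ EdgeColoring G Δ
  not-colourable ψ = by-cases (any? λ y → any? λ z →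
      (A y ≟ᵇ true) ×-dec (A z ≟ᵇ false) ×-dec (Adj R y v ≟ᵇ true) ×-dec (Adj R z v ≟ᵇ true) ×-dec (C (suc v) (suc y) ≟ C zero (suc z)))
    where
    open EdgeColoring ψ renaming (col to C)
    at-v : Fin m → Fin Δ
    at-v y = if A y then C (suc v) (suc y) else C zero (suc y)
    by-cases : Dec (∃₂ λ y z → A y ≡ true × A z ≡ false × Adj R y v ≡ true × Adj R z v ≡ true × C (suc v) (suc y) ≡ C zero (suc z)) → _
    by-cases (yes (y , z , Ay , Az , yv , zv , eq)) = perfectMatching-parity (factor c) (colourClass ψ c sees)
      where
      c = C (suc v) (suc y)
      sees-suc : ∀ x → Dec (x ≡ v) → ∃ λ Y → Adj G (suc x) Y ≡ true × C (suc x) Y ≡ c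
      sees-suc x (yes refl) = suc y , adjacent R v A (v₁- (near⇒≢ yv) yv Ay) , refl
      sees-suc x (no x≢v) with w , xw , eq′ ← all-colours R regular {x} (C (suc x) ∘ lift R v A x)
        (λ xy xz e → lift-injective R v A {x} (colouredNeighbour-unique ψ (lift-adjacent R v A x≢v xy) (lift-adjacent R v A x≢v xz) e)) c
        = lift R v A x w , lift-adjacent R v A x≢v xw , eq′
      sees : ∀ X → ∃ λ Y → Adj G X Y ≡ true × C X Y ≡ c
      sees zero    = suc z , adjacent R v A (v₂- (near⇒≢ zv) zv Az) , ≡-sym eq
      sees (suc x) = sees-suc x (x ≟ v)
    -- Without a shared colour, the `Δ` edges in question carry all `Δ` colours, including that of
    -- the edge joining `v₁` and `v₂`, to which each of them is adjacent.
    by-cases (no none) with all-colours R regular {v} at-v at-v-injective (C zero (suc v))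
      where
      at-v-injective : ∀ {y z} → Adj R v y ≡ true → Adj R v z ≡ true → at-v y ≡ at-v z → y ≡ z
      at-v-injective {y} {z} vy vz eq with trans (sym R y v) vy | trans (sym R z v) vz | A y in Ay | A z in Az
      ... | yv | zv | true  | true  = suc-injective (colouredNeighbour-unique ψ (adjacent R v A (v₁- (near⇒≢ yv) yv Ay)) (adjacent R v A (v₁- (near⇒≢ zv) zv Az)) eq)
      ... | yv | zv | true  | false = contradiction (y , z , Ay , Az , yv , zv , eq) none
      ... | yv | zv | false | true  = contradiction (z , y , Az , Ay , zv , yv , ≡-sym eq) none
      ... | yv | zv | false | false = suc-injective (colouredNeighbour-unique ψ (adjacent R v A (v₂- (near⇒≢ yv) yv Ay)) (adjacent R v A (v₂- (near⇒≢ zv) zv Az)) eq)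
    ... | y , vy , eq with trans (sym R y v) vy | A y in Ay
    ...   | yv | true  = 0≢1+n (colouredNeighbour-unique ψ (adjacent R v A v₁v₂) (adjacent R v A (v₁- (near⇒≢ yv) yv Ay))
      (trans (≡-sym (colSym zero (suc v) (adjacent R v A v₂v₁))) (≡-sym eq)))
    ...   | yv | false = near⇒≢ yv (suc-injective (colouredNeighbour-unique ψ (adjacent R v A (v₂- (near⇒≢ yv) yv Ay)) (adjacent R v A v₂v₁) eq))

  Δ<colours : ∀ j → EdgeColoring G j → suc Δ ≤ j
  Δ<colours j ψ with suc Δ ≤? j
  ... | yes Δ<j = Δ<j
  ... | no Δ≮j  = contradiction (weaken-colours (≤-pred (≰⇒> Δ≮j)) ψ) not-colourable

-- Colouring all edges but one

module _ {R : Graph m} {Δ : ℕ} (regular : Regular R Δ) (dense : 2 * suc m ≤ 3 * Δ + 4)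
         (F : Factorisation Δ R) (v : Fin m) (A : Fin m → Bool) (valid : ValidSplit R v A) where
  open Factorisation F

  private
    G : Graph (suc m)
    G = splitGraph R v A

    inside : ∀ {x y} → x ≢ v → y ≢ v → Adj R x y ≡ true → Adj G (suc x) (suc y) ≡ true
    inside x≢v y≢v xy = adjacent R v A (off x≢v y≢v xy)

    near⇒≢ : ∀ {x} → Adj R x v ≡ true → x ≢ v
    near⇒≢ = adjacent⇒≢ R

    apart⇒≢ : ∀ {x y} → Adj R x v ≡ true → Adj R y v ≡ false → x ≢ y
    apart⇒≢ xv yv refl = true≢false (trans (≡-sym xv) yv)

  -- The theorem is symmetric in v₁ and v₂: p and q are these two vertices in either order.
  record Ends (p q : Fin (suc m)) : Set where
    field
      colouring : SplitColouring Δ G p q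
      p≢q       : p ≢ q
      p-off     : ∀ {x} → x ≢ v → p ≢ suc x
      q-off     : ∀ {x} → x ≢ v → q ≢ suc x
      attached  : ∀ {x} → Adj R x v ≡ true → Adj G p (suc x) ≡ true ⊎ Adj G q (suc x) ≡ true
      u         : Fin m
      u∼v       : Adj R u v ≡ true
      u∼q       : Adj G q (suc u) ≡ true
    open SplitColouring colouring public

    far-ends : ∀ {x z w} → x ≢ v → z ≢ v → w ≢ v → x ≢ z → x ≢ w → z ≢ w → Unique (p ∷ q ∷ suc x ∷ suc z ∷ suc w ∷ [])
    far-ends x≢v z≢v w≢v x≢z x≢w z≢w =
      (p≢q ∷ p-off x≢v ∷ p-off z≢v ∷ p-off w≢v ∷ []) ∷ (q-off x≢v ∷ q-off z≢v ∷ q-off w≢v ∷ []) ∷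
      (x≢z ∘ suc-injective ∷ x≢w ∘ suc-injective ∷ []) ∷ (z≢w ∘ suc-injective ∷ []) ∷ [] ∷ []

    -- The colour of the edge from `q` to `suc u`. Being present at `q`, it is the colour missing at
    -- `p` that the local lemmas start from.
    γ : Fin Δ
    γ = proj₁ (colour-p (swapEnds colouring) (≢-sym p≢q) (p-off (near⇒≢ u∼v)) u∼q)

    γ-edge : μ γ q ≡ suc u
    γ-edge = proj₂ (colour-p (swapEnds colouring) (≢-sym p≢q) (p-off (near⇒≢ u∼v)) u∼q)

    missing-p : ∀ {c x} → x ≢ v → μ c q ≡ suc x → missing μ c p ≡ true
    missing-p {c} x≢v eq = trans (SplitColouring.exclusive (swapEnds colouring) c) (cong not (present (swapEnds colouring) eq (q-off x≢v)))

    γ-missing : missing μ γ p ≡ true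
    γ-missing = missing-p (near⇒≢ u∼v) γ-edge

  end₁ : Ends (suc v) zero
  end₁ = record
    { colouring = splitColouring F v A ; p≢q = λ () ; p-off = λ x≢v eq → x≢v (≡-sym (suc-injective eq)) ; q-off = λ _ ()
    ; attached = attached ; u = proj₁ (proj₂ valid) ; u∼v = proj₁ (proj₂ (proj₂ valid))
    ; u∼q = adjacent R v A (v₂- (near⇒≢ (proj₁ (proj₂ (proj₂ valid)))) (proj₁ (proj₂ (proj₂ valid))) (proj₂ (proj₂ (proj₂ valid)))) }
    where
    attached : ∀ {x} → Adj R x v ≡ true → Adj G (suc v) (suc x) ≡ true ⊎ Adj G zero (suc x) ≡ true
    attached {x} xv = by-side _ refl
      where
      by-side : ∀ b → A x ≡ b → Adj G (suc v) (suc x) ≡ true ⊎ Adj G zero (suc x) ≡ true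
      by-side true  Ax = inj₁ (adjacent R v A (v₁- (near⇒≢ xv) xv Ax))
      by-side false Ax = inj₂ (adjacent R v A (v₂- (near⇒≢ xv) xv Ax))

  end₂ : Ends zero (suc v)
  end₂ = record
    { colouring = swapEnds (splitColouring F v A) ; p≢q = λ () ; p-off = λ _ () ; q-off = Ends.p-off end₁
    ; attached = [ inj₂ , inj₁ ]′ ∘ Ends.attached end₁ ; u = proj₁ (proj₁ valid) ; u∼v = proj₁ (proj₂ (proj₁ valid))
    ; u∼q = adjacent R v A (v₁- (near⇒≢ (proj₁ (proj₂ (proj₁ valid)))) (proj₁ (proj₂ (proj₁ valid))) (proj₂ (proj₂ (proj₁ valid)))) }

  attachedEnd : ∀ {x} → Adj R x v ≡ true → ∃₂ λ p q → Ends p q × Adj G p (suc x) ≡ true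
  attachedEnd xv with Ends.attached end₁ xv
  ... | inj₁ e = _ , _ , end₁ , e
  ... | inj₂ e = _ , _ , end₂ , e

  near-edge : ∀ {x w} → x ≢ v → w ≢ v → Adj R x v ≡ true → Adj R x w ≡ true → ColourableWithout Δ G (suc x) (suc w)
  near-edge {x} {w} x≢v w≢v xv xw with p , q , E , px ← attachedEnd xv =
    without-near colouring ((p≢q ∷ p-off x≢v ∷ p-off w≢v ∷ []) ∷ (q-off x≢v ∷ q-off w≢v ∷ []) ∷ (adjacent⇒≢ R xw ∘ suc-injective ∷ []) ∷ [] ∷ [])
      px (inside x≢v w≢v xw) γ-missing
    where open Ends E

  far-edge : ∀ {z w} → z ≢ v → w ≢ v → Adj R z v ≡ false → Adj R w v ≡ false → Adj R z w ≡ true → ColourableWithout Δ G (suc z) (suc w)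
  far-edge {z} {w} z≢v w≢v zv wv zw with commonNeighbour₂ {R = R} regular dense (≢-sym z≢v) (trans (sym R v z) zv)
  ... | x , vx , zx with attachedEnd (trans (sym R x v) vx)
  ... | p , q , E , px with any? (λ c → ¬? (Ends.γ E ≟ c) ×-dec (missing (Ends.μ E) c p ≟ᵇ true))
  ... | yes (γ′ , γ≢γ′ , γ′∈) = without-path colouring (far-ends x≢v z≢v w≢v (≢-sym (adjacent⇒≢ R zx)) (apart⇒≢ xv wv) z≢w)
      px (inside x≢v z≢v (trans (sym R x z) zx)) (inside z≢v w≢v zw) γ≢γ′ γ-missing γ′∈
    where
    open Ends E
    z≢w = adjacent⇒≢ R zw
    xv  = trans (sym R x v) vx
    x≢v = near⇒≢ xv
  -- Now `p` misses `γ` alone, so `q` misses all other colours and `suc u` is its only neighbour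
  -- besides `p`.
  ... | no none = by-cases _ refl
    where
    open Ends E
    z≢w = adjacent⇒≢ R zw
    u≢v = near⇒≢ u∼v
    only : ∀ c → missing μ c p ≡ true → c ≡ γ
    only c c∈ with γ ≟ c
    ... | yes γ≡c = ≡-sym γ≡c
    ... | no γ≢c  = contradiction (c , γ≢c , c∈) none
    missing-q : ∀ {c} → c ≢ γ → missing μ c q ≡ true
    missing-q {c} c≢γ with missing μ c p in eq | exclusive c
    ... | true  | _   = contradiction (only c eq) c≢γ
    ... | false | eq′ = eq′
    by-cases : ∀ b → Adj R u z ≡ b → ColourableWithout Δ G (suc z) (suc w)
    -- The path now starts `p q` instead of `q p`. As `v` is adjacent to neither `z` nor `w`, the
    -- degree is at least 4, which leaves two colours besides `γ`, both missing at `q`.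
    by-cases true uz with β , β′ , β≢β′ , β≢γ , β′≢γ ← two-others (≤-trans (m≤n+m 3 1)
        (large-degree {R = R} regular dense (≢-sym z≢v) (≢-sym w≢v) z≢w (trans (sym R v z) zv) (trans (sym R v w) wv))) γ
      = without-path (swapEnds colouring)
          ((≢-sym p≢q ∷ q-off u≢v ∷ q-off z≢v ∷ q-off w≢v ∷ []) ∷ (p-off u≢v ∷ p-off z≢v ∷ p-off w≢v ∷ []) ∷
           (adjacent⇒≢ R uz ∘ suc-injective ∷ apart⇒≢ u∼v wv ∘ suc-injective ∷ []) ∷ (z≢w ∘ suc-injective ∷ []) ∷ [] ∷ [])
          u∼q (inside u≢v z≢v uz) (inside z≢v w≢v zw) β≢β′ (missing-q β≢γ) (missing-q β′≢γ)
    -- `v` and `u` are adjacent and neither is adjacent to `z`, so the three have a common neighbour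
    -- `y`, which closes the kite.
    by-cases false uz with commonNeighbour₃ {R = R} regular dense (trans (sym R v u) u∼v) (trans (sym R v z) zv) uz (≢-sym z≢v)
    ... | y , vy , uy , zy = without-kite colouring
        ((p≢q ∷ p-off u≢v ∷ p-off y≢v ∷ p-off z≢v ∷ p-off w≢v ∷ []) ∷ (q-off u≢v ∷ q-off y≢v ∷ q-off z≢v ∷ q-off w≢v ∷ []) ∷
         (u≢y ∘ suc-injective ∷ apart⇒≢ u∼v zv ∘ suc-injective ∷ apart⇒≢ u∼v wv ∘ suc-injective ∷ []) ∷
         (apart⇒≢ yv zv ∘ suc-injective ∷ apart⇒≢ yv wv ∘ suc-injective ∷ []) ∷ (z≢w ∘ suc-injective ∷ []) ∷ [] ∷ [])
        (p-side (attached yv)) (inside u≢v y≢v uy) (inside y≢v z≢v (trans (sym R y z) zy)) (inside z≢v w≢v zw) γ-edge only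
      where
      yv  = trans (sym R y v) vy
      y≢v = near⇒≢ yv
      u≢y = adjacent⇒≢ R uy
      -- If `y` were attached to `q`, the colour of that edge would be missing at `p`, hence equal
      -- to `γ`, and `y` would be `u`.
      p-side : Adj G p (suc y) ≡ true ⊎ Adj G q (suc y) ≡ true → Adj G p (suc y) ≡ true
      p-side (inj₁ py) = py
      p-side (inj₂ qy) with c , eq ← colour-p (swapEnds colouring) (≢-sym p≢q) (p-off y≢v) qy
        with refl ← only c (missing-p y≢v eq) = contradiction (suc-injective (trans (≡-sym γ-edge) eq)) u≢y

  without-edge : ∀ {X Y} → Neighbour R v A X Y → ColourableWithout Δ G X Y
  without-edge v₂v₁ = colourable-sym {G = G} (without-edge v₁v₂)
  without-edge v₁v₂ = without-pq (splitColouring F v A)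
  without-edge (-v₂ y≢v yv Ay) = colourable-sym {G = G} (without-edge (v₂- y≢v yv Ay))
  without-edge (-v₁ y≢v yv Ay) = colourable-sym {G = G} (without-edge (v₁- y≢v yv Ay))
  without-edge (v₂- y≢v yv Ay) = without-end colouring ((p≢q ∷ p-off y≢v ∷ []) ∷ (q-off y≢v ∷ []) ∷ [] ∷ []) (adjacent R v A (v₂- y≢v yv Ay))
    where open Ends end₂
  without-edge (v₁- y≢v yv Ay) = without-end colouring ((p≢q ∷ p-off y≢v ∷ []) ∷ (q-off y≢v ∷ []) ∷ [] ∷ []) (adjacent R v A (v₁- y≢v yv Ay))
    where open Ends end₁
  without-edge (off {x} {y} x≢v y≢v xy) = by-cases _ _ refl refl
    where
    by-cases : ∀ b b′ → Adj R x v ≡ b → Adj R y v ≡ b′ → ColourableWithout Δ G (suc x) (suc y)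
    by-cases true  _     xv yv = near-edge x≢v y≢v xv xy
    by-cases false true  xv yv = colourable-sym {G = G} (near-edge y≢v x≢v yv (trans (sym R y x) xy))
    by-cases false false xv yv = far-edge x≢v y≢v xv yv xy

-- Criticality

proper-subgraph-colourable : ∀ {H : Graph n} {G : Graph N} {f} → IsSubgraphVia H G f → IsProperVia H G f →
  (∀ X → ∃ λ Y → Adj G X Y ≡ true) → (∀ {X Y} → Adj G X Y ≡ true → ColourableWithout (suc k) G X Y) → EdgeColoring H (suc k)
proper-subgraph-colourable {H = H} {G} {f} (f-inj , f-hom) proper some-nbr without = colour-avoiding (avoided proper)
  where
  Avoided : Set
  Avoided = ∃₂ λ X Y → Adj G X Y ≡ true × (∀ a b → Adj H a b ≡ true → ¬ SameEdge (f a) (f b) X Y)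
  avoided : IsProperVia H G f → Avoided
  -- An omitted vertex is reduced to an omitted edge: any edge of `G` at `X` will do.
  avoided (inj₁ (X , X∉)) with Y , XY ← some-nbr X = X , Y , XY , λ
    { a b _ (inj₁ (eq , _)) → X∉ a eq
    ; a b _ (inj₂ (_ , eq)) → X∉ b eq }
  avoided (inj₂ (a , b , ab , ¬ab)) = f a , f b , ab , λ
    { a′ b′ e (inj₁ (eq , eq′)) → absent (f-inj a′ a eq) (f-inj b′ b eq′) e
    ; a′ b′ e (inj₂ (eq , eq′)) → absent (f-inj b′ a eq′) (f-inj a′ b eq) (trans (sym H b′ a′) e) }
    where
    absent : ∀ {a′ b′} → a′ ≡ a → b′ ≡ b → Adj H a′ b′ ≢ true
    absent refl refl e = true≢false (trans (≡-sym e) ¬ab)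
  colour-avoiding : Avoided → EdgeColoring H (suc _)
  colour-avoiding (X , Y , XY , avoids) with μ , inv , covers ← without XY =
    matchings⇒colouring {μ = μ} f f-inj inv λ a b ab → [ (λ se → contradiction se (avoids a b ab)) , id ]′ (covers (f a) (f b) (f-hom a b ab))

theorem1 : (m Δ : ℕ) → 1 ≤ suc m → 1 ≤ Δ → 2 * suc m ≤ 3 * Δ + 4 →
    (R : Graph m) → Connected R → Regular R Δ → Class1 R →
    (v : Fin m) (A : Fin m → Bool) → ValidSplit R v A →
    ΔCritical (splitGraph R v A)
theorem1 m (suc Δ) _ _ dense R _ regular class1 v A valid = critical , chromaticIndex
  where
  F : Factorisation (suc Δ) R
  F = factorise regular (proj₁ (class1 (suc Δ) ((λ x → ≤-reflexive (regular x)) , inj₂ (v , regular v))))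
  critical : EdgeChromaticCritical (splitGraph R v A)
  -- A colouring of `H` with `suc Δ` colours bounds `k′` by `suc Δ`, while every colouring of `G`
  -- needs one colour more.
  critical n H f sub proper k k′ (ψ , _) (_ , minimal) = ≤-trans
    (s≤s (minimal (suc Δ) (proper-subgraph-colourable {G = splitGraph R v A} sub proper (some-neighbour F v A zero)
      (λ e → without-edge regular dense F v A valid (neighbour R v A _ _ e)))))
    (Δ<colours regular F v A k ψ)
  chromaticIndex : ∀ d → IsMaxDegree (splitGraph R v A) d → IsChromaticIndex (splitGraph R v A) (suc d)
  chromaticIndex d max rewrite isMaxDegree-unique R v A valid regular max =
    colouring-Δ+1 F v A , Δ<colours regular F v A
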